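{- Let $T=(V,E)$ be a tree which is not a path. For every $k\in\{1,\ldots,\varsigma(T)\}$, $$\operatorname{pd}_k(T)\le k\kappa+\mathcal{I}_k(T)+1,$$ where $\kappa=|\mathcal{M}(T)|$.
   Context: All graphs are finite, simple, connected and have at least two vertices; $d$ is the shortest-path distance. Partition dimension: for a vertex $a$ and a nonempty vertex set $S$, $d(a,S)=\min_{v\in S}d(a,v)$; $S$ distinguishes different vertices $x,y$ if $d(x,S)\neq d(y,S)$. A partition $\Pi$ of the vertex set (into nonempty sets) is a $k$-partition generator if every pair of different vertices is distinguished by at least $k$ of the sets of $\Pi$. The $k$-partition dimension $\operatorname{pd}_k(T)$ is the minimum cardinality of a $k$-partition generator of $T$ (these exist for all $k\in\{1,\ldots,\varsigma(T)\}$, with $\varsigma(T)$ as defined below). Tree notions: a major vertex is a vertex of degree at least three. An end vertex (vertex of degree one) $u$ is a terminal vertex of a major vertex $v$ if $d(u,v)<d(u,w)$ for every other major vertex $w$. $U(v)$ denotes the set of terminal vertices of $v$, and the terminal degree of $v$ is $\operatorname{ter}(v)=|U(v)|$. $\mathcal{M}(T)$ is the set of major vertices of $T$ having terminal degree greater than one. For $w\in\mathcal{M}(T)$ and $u\in U(w)$ let $l(u,w)=d(u,w)$ be the length of the shortest path from $u$ to $w$. For different $u,v\in U(w)$ let $\varsigma(u,v)=l(u,w)+l(v,w)$ be the length of the path from $u$ to $v$ through $w$. Put $\varsigma(w)=\min_{u,v\in U(w),u\neq v}\varsigma(u,v)$, $l(w)=\min_{u\in U(w)}l(u,w)$ and $\varsigma(T)=\min_{w\in\mathcal{M}(T)}\varsigma(w)$.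 The parameter $\mathcal{I}_k(T)$: let $l_1<l_2<\cdots<l_r$ be the distinct values of $l(w)$ for $w\in\mathcal{M}(T)$, and let $\mathcal{M}_i(T)=\{w\in\mathcal{M}(T): l(w)=l_i\}$ for $1\le i\le r$. Let $t_i=\max_{w\in\mathcal{M}_i(T)}|U(w)|$. For $k\in\{1,\ldots,\varsigma(T)\}$ let $s_k$ be the maximum subscript such that $l_{s_k}\le\lfloor k/2\rfloor$; if $l_1>\lfloor k/2\rfloor$, put $s_k=1$. With the convention that $\max_{s_k<j\le r}\{t_j\}=0$ when $s_k=r$, define $$\mathcal{I}_k(T)=(t_1-2)\max\left\{k-l_1,\left\lceil\tfrac{k}{2}\right\rceil\right\}+\sum_{i=2}^{s_k}\max\left\{t_i-\max_{1\le j<i}\{t_j\},0\right\}(k-l_i)+\max\left\{\max_{s_k<j\le r}\{t_j\}-\max_{1\le j\le s_k}\{t_j\},0\right\}\left\lceil\tfrac{k}{2}\right\rceil.$$ -}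

module Defs where

open import Data.Fin.Base using (Fin; zero; suc; toℕ; fromℕ; inject₁)
open import Data.Fin.Permutation using (Permutation′; _⟨$⟩ʳ_)
import Data.Fin.Properties as Fin
open import Data.Fin.Subset using (Subset; _∈_; Nonempty)
open import Data.Fin.Subset.Properties using (_∈?_)
open import Data.List.Base
  using (List; []; _∷_; allFin; applyUpTo; cartesianProduct; deduplicate; filter; length; map)
open import Data.List.Extrema.Nat using (min; max)
open import Data.Nat.Base
  using (ℕ; zero; suc; _+_; _*_; _∸_; _≤_; _<_; _⊔_; z≤n; s≤s; ∣_-_∣; ⌊_/2⌋; ⌈_/2⌉)
open import Data.Nat.ListAction using (sum)
open import Data.Nat.Properties using (_≟_; _≤?_; _<?_; ≤-decTotalOrder)
open import Data.List.Sort.InsertionSort.Base ≤-decTotalOrder using (sort)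
open import Data.Product using (∃; ∃₂; ∃!; ∃-syntax; _×_; _,_; proj₁; uncurry)
open import Data.Vec.Base using (Vec; lookup; count)
open import Function.Bundles using (_⇔_)
open import Function.Definitions using (Injective)
open import Level using (0ℓ)
open import Relation.Binary.Core using (Rel)
open import Relation.Binary.Definitions using (Irreflexive; Symmetric) renaming (Decidable to Decidable₂)
open import Relation.Binary.PropositionalEquality using (_≡_; _≢_; refl)
open import Relation.Nullary using (¬_; Dec; yes; no; ¬?; contradiction)
open import Relation.Nullary.Decidable using (map′; _×-dec_; _→-dec_)
open import Relation.Unary using (Pred; Decidable)

IsLeast : Pred ℕ 0ℓ → Pred ℕ 0ℓ
IsLeast P m = P m × (∀ j → P j → m ≤ j)

least : {P : Pred ℕ 0ℓ} → Decidable P → ∃ P → ∃ (IsLeast P)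
least P? (m , pm) = go P? m pm
  where
  go : {P : Pred ℕ 0ℓ} → Decidable P → ∀ m → P m → ∃ (IsLeast P)
  go P? m pm with P? 0
  ... | yes p0 = 0 , p0 , λ _ _ → z≤n
  go P? zero    p0 | no ¬p0 = contradiction p0 ¬p0
  go P? (suc m) pm | no ¬p0 with go (λ j → P? (suc j)) m pm
  ... | j , pj , j-min = suc j , pj , λ where
    zero    p0 → contradiction p0 ¬p0
    (suc i) pi → s≤s (j-min i pi)

-- The value 0 at [] is a placeholder.  Distances to a vertex set matter only for
-- the (nonempty) members of a partition; in a tree that is not a path, 𝓜 is
-- nonempty and its members have at least two terminal vertices.
minimum : List ℕ → ℕ
minimum []       = 0
minimum (x ∷ xs) = min x xs

maximum : List ℕ → ℕ
maximum = max 0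

-- The integers from a to b, both included; empty when b < a.
[_⋯_] : ℕ → ℕ → List ℕ
[ a ⋯ b ] = applyUpTo (a +_) (suc b ∸ a)

-- Entry number i of a list, counted from 1 (and 0 outside 1, …, length).
entry : List ℕ → ℕ → ℕ
entry (x ∷ xs) 1             = x
entry (x ∷ xs) (suc (suc i)) = entry xs (suc i)
entry _        _             = 0

record Graph (n : ℕ) : Set₁ where
  infix 4 _~_ _~?_
  field
    _~_      : Rel (Fin n) 0ℓ
    _~?_     : Decidable₂ _~_
    ~-sym    : Symmetric _~_
    ~-irrefl : Irreflexive _≡_ _~_

module _ {n : ℕ} (G : Graph n) where
  open Graph G

  data Walk : Fin n → Fin n → ℕ → Set where
    []  : ∀ {x} → Walk x x 0
    _∷_ : ∀ {x y z m} → x ~ y → Walk y z m → Walk x z (suc m)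

  walk? : ∀ x y → Decidable (Walk x y)
  walk? x y zero = map′ (λ { refl → [] }) (λ { [] → refl }) (x Fin.≟ y)
  walk? x z (suc m) =
    map′ (λ { (_ , e , w) → e ∷ w }) (λ { (e ∷ w) → _ , e , w })
         (Fin.any? λ y → (x ~? y) ×-dec walk? y z m)

  Connected : Set
  Connected = ∀ x y → ∃ (Walk x y)

  -- A cycle of length 3 + m, given by its distinct vertices in cyclic order.
  IsCycle : ∀ m → (Fin (3 + m) → Fin n) → Set
  IsCycle m c = Injective _≡_ _≡_ c
              × (∀ (i : Fin (2 + m)) → c (inject₁ i) ~ c (suc i))
              × c (fromℕ (2 + m)) ~ c zero

  Acyclic : Set
  Acyclic = ¬ ∃₂ IsCycle

  -- Isomorphic to the path 0 – 1 – ⋯ – n-1.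
  IsPath : Set
  IsPath = ∃[ π ] ∀ (i j : Fin n) →
    ((π ⟨$⟩ʳ i) ~ (π ⟨$⟩ʳ j)) ⇔ (∣ toℕ i - toℕ j ∣ ≡ 1)

record Tree (n : ℕ) : Set₁ where
  field
    graph      : Graph n
    nontrivial : 2 ≤ n
    connected  : Connected graph
    acyclic    : Acyclic graph
  open Graph graph public

module _ {n : ℕ} (T : Tree n) where
  open Tree T

  private
    V : Set
    V = Fin n

  shortest : ∀ x y → ∃ (IsLeast (Walk graph x y))
  shortest x y = least (walk? graph x y) (connected x y)

  d : V → V → ℕ
  d x y = proj₁ (shortest x y)

  d-set : V → Subset n → ℕ
  d-set a S = minimum (map (d a) (filter (_∈? S) (allFin n)))

  Distinguishes : V → V → Subset n → Set
  Distinguishes x y S = d-set x S ≢ d-set y S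

  distinguishes? : ∀ x y → Decidable (Distinguishes x y)
  distinguishes? x y S = ¬? (d-set x S ≟ d-set y S)

  IsPartition : ∀ {m} → Vec (Subset n) m → Set
  IsPartition Π = (∀ i → Nonempty (lookup Π i))
                × (∀ x → ∃! _≡_ λ i → x ∈ lookup Π i)

  IsPartitionGenerator : ℕ → ∀ {m} → Vec (Subset n) m → Set
  IsPartitionGenerator k Π = IsPartition Π
    × (∀ x y → x ≢ y → k ≤ count (distinguishes? x y) Π)

  IsPartitionDimension : ℕ → ℕ → Set
  IsPartitionDimension k = IsLeast λ m → ∃[ Π ] IsPartitionGenerator k {m} Π

  degree : V → ℕ
  degree v = length (filter (v ~?_) (allFin n))

  Major : Pred V 0ℓ
  Major v = 3 ≤ degree v

  major? : Decidable Major
  major? v = 3 ≤? degree v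

  End : Pred V 0ℓ
  End u = degree u ≡ 1

  TerminalOf : V → Pred V 0ℓ
  TerminalOf v u = End u × Major v × (∀ w → Major w → w ≢ v → d u v < d u w)

  terminalOf? : ∀ v → Decidable (TerminalOf v)
  terminalOf? v u = (degree u ≟ 1) ×-dec major? v ×-dec
    Fin.all? λ w → major? w →-dec (¬? (w Fin.≟ v) →-dec (d u v <? d u w))

  U : V → List V
  U v = filter (terminalOf? v) (allFin n)

  ter : V → ℕ
  ter v = length (U v)

  𝓜 : List V
  𝓜 = filter (λ v → major? v ×-dec (1 <? ter v)) (allFin n)

  κ : ℕ
  κ = length 𝓜

  l-vertex : V → ℕ
  l-vertex w = minimum (map (λ u → d u w) (U w))

  ς-pair : V → V → V → ℕ
  ς-pair w u v = d u w + d v w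

  ς-vertex : V → ℕ
  ς-vertex w = minimum (map (uncurry (ς-pair w))
    (filter (λ (u , v) → ¬? (u Fin.≟ v)) (cartesianProduct (U w) (U w))))

  ς : ℕ
  ς = minimum (map ς-vertex 𝓜)

  levels : List ℕ
  levels = deduplicate _≟_ (sort (map l-vertex 𝓜))

  r : ℕ
  r = length levels

  l : ℕ → ℕ
  l = entry levels

  𝓜-level : ℕ → List V
  𝓜-level i = filter (λ w → l-vertex w ≟ l i) 𝓜

  t : ℕ → ℕ
  t i = maximum (map ter (𝓜-level i))

  -- Largest t j with a ≤ j ≤ b, and 0 if there is no such j.
  t-max : ℕ → ℕ → ℕ
  t-max a b = maximum (map t [ a ⋯ b ])

  -- The default 1 of max covers l 1 > ⌊ k /2⌋ and is harmless otherwise.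
  s : ℕ → ℕ
  s k = max 1 (filter (λ i → l i ≤? ⌊ k /2⌋) [ 1 ⋯ r ])

  -- a ∸ b is max {a - b, 0}.  The remaining subtractions agree with the integer
  -- ones: t 1 ≥ 2 by the definition of 𝓜; k ∸ l 1 occurs in a maximum with a
  -- nonnegative number; and l i ≤ ⌊ k /2⌋ whenever 2 ≤ i ≤ s k.
  𝓘 : ℕ → ℕ
  𝓘 k = (t 1 ∸ 2) * ((k ∸ l 1) ⊔ ⌈ k /2⌉)
      + sum (map (λ i → (t i ∸ t-max 1 (i ∸ 1)) * (k ∸ l i)) [ 2 ⋯ s k ])
      + (t-max (suc (s k)) r ∸ t-max 1 (s k)) * ⌈ k /2⌉

{-# OPTIONS --safe #-}
module Submission where

-- A hub is a member of 𝓜, and its legs are the paths to its terminal vertices,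
-- a shortest leg first.  At each hub w, colour the first min {l w, ⌊ k /2⌋}
-- vertices of the first leg and the first max {k - l w, ⌈ k /2⌉} vertices of
-- each other leg, counted from w; since k ≤ ς T, the legs are long enough, and
-- any two legs carry at least k colours.  The vertices on the first two legs get
-- k private colours per hub.  On leg number i ≥ 2, counting from 0, the vertex at
-- position p gets a colour (i , p) shared by all hubs; 𝓘 T k counts these pairs.
-- One more colour is used for all remaining vertices, and the colour classes form
-- the partition.
--
-- If x and y are equidistant from some vertex, let m be the midpoint of the path
-- between them.  A colour class without vertices behind m on the side of y, but
-- with some on the side of x, distinguishes x and y.  If one of these two
-- branches at m contains a hub, the private colours of this hub do, except that
-- of m when m lies on one of its first two legs; the third branch at the hub then
-- contains a further hub, or is a third leg with a shared colour.  If neither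
-- branch contains a hub, they are legs of the hub m, and their colours do: a
-- vertex of the same shared colour at another hub is farther from m, since m is
-- not the major vertex nearest to it.

open import Data.Bool.Base using (true; false)
open import Data.Empty using (⊥)
open import Data.Fin.Base using (Fin; zero; suc; toℕ; fromℕ; fromℕ<; inject₁)
open import Data.Fin.Permutation using (permutation)
import Data.Fin.Properties as Fin
open import Data.Fin.Subset using (Subset) renaming (_∈_ to _∈ₛ_)
open import Data.Fin.Subset.Properties using (_∈?_; anySubset?; nonempty?)
open import Data.List.Base
  using (List; []; _∷_; _++_; _∷ʳ_; length; lookup; map; filter; concatMap; tabulate; allFin
        ; applyUpTo; cartesianProduct; deduplicate)
open import Data.List.Extrema.Nat
  using (max; argmax; min≤v⁺; v≤max⁺; max≤v⁺; argmin-sel; argmax-sel; argmax-all; f[xs]≤f[argmax])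
open import Data.List.Membership.Propositional using (_∈_; lose)
open import Data.List.Membership.Propositional.Properties
open import Data.List.Properties using (length-++; length-map; length-tabulate; length-applyUpTo; map-cong)
open import Data.List.Relation.Binary.Permutation.Propositional
  using (_↭_; ↭-refl; ↭-prep; ↭-swap; ↭-trans; ↭-sym; ↭⇒↭ₛ)
open import Data.List.Relation.Binary.Permutation.Propositional.Properties using (∈-resp-↭; ↭-length)
import Data.List.Relation.Binary.Permutation.Setoid.Properties as Permutationₛ
open import Data.List.Relation.Unary.All as All using (All; []; _∷_)
import Data.List.Relation.Unary.All.Properties as All
open import Data.List.Relation.Unary.AllPairs using (AllPairs; []; _∷_)
import Data.List.Relation.Unary.AllPairs.Properties as AllPairs
open import Data.List.Relation.Unary.Any as Any using (here; there; index)
open import Data.List.Relation.Unary.Any.Properties using (lookup-index)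
open import Data.List.Relation.Unary.Linked.Properties using (Linked⇒AllPairs)
open import Data.List.Relation.Unary.Unique.DecPropositional.Properties using (deduplicate-!)
open import Data.List.Relation.Unary.Unique.Propositional using (Unique)
import Data.List.Relation.Unary.Unique.Propositional.Properties as Unique
open import Data.Nat.Base
open import Data.Nat.ListAction using (sum)
open import Data.Nat.Properties
open import Data.List.Sort.InsertionSort.Properties ≤-decTotalOrder using (sort-↭; sort-↗)
open import Data.Product using (∃; ∃₂; ∃!; ∃-syntax; _×_; _,_; proj₁; proj₂; uncurry)
import Data.Product.Properties as Product
open import Data.Sum.Base using (_⊎_; inj₁; inj₂; [_,_]′)
import Data.Sum.Properties as Sum
open import Data.Unit.Base using (⊤; tt)
open import Data.Vec.Base as Vec using (Vec; []; _∷_; fromList; count)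
open import Data.Vec.Properties using (lookup∘tabulate; []=⇒lookup; lookup⇒[]=)
open import Function.Base using (_∘_; case_of_)
open import Function.Bundles using (_⇔_; mk⇔)
open import Function.Definitions using (Injective)
open import Level using (0ℓ)
open import Relation.Binary.Definitions using (DecidableEquality; Tri; tri<; tri≈; tri>)
open import Relation.Binary.PropositionalEquality
open import Relation.Nullary using (¬_; Dec; yes; no; does; contradiction; ¬?; _×-dec_; _→-dec_)
open import Relation.Nullary.Decidable using (dec-true; map′)
open import Relation.Unary using (Pred; Decidable)
open import Defs

-- Lists without repetitions

lookup-injective : ∀ {a} {A : Set a} {xs : List A} → Unique xs →
  ∀ {i j} → lookup xs i ≡ lookup xs j → i ≡ j
lookup-injective (_  ∷ _)   {zero}  {zero}  _  = refl
lookup-injective (x∉ ∷ _)   {zero}  {suc j} eq = contradiction eq (All.lookup x∉ (∈-lookup j))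
lookup-injective (x∉ ∷ _)   {suc i} {zero}  eq = contradiction (sym eq) (All.lookup x∉ (∈-lookup i))
lookup-injective (_  ∷ xs!) {suc i} {suc j} eq = cong suc (lookup-injective xs! eq)

-- Sending each position of `xs` to a position of the same entry in `ys` is injective, so the
-- pigeonhole principle applies.
unique-⊆-length : ∀ {a} {A : Set a} {xs ys : List A} →
  Unique xs → (∀ {x} → x ∈ xs → x ∈ ys) → length xs ≤ length ys
unique-⊆-length {xs = xs} {ys} xs! xs⊆ys = Fin.injective⇒≤ {f = pos} λ {i} {j} eq →
  lookup-injective xs! (trans (lookup-index (∈ys i)) (trans (cong (lookup ys) eq) (sym (lookup-index (∈ys j)))))
  where
  ∈ys : ∀ i → lookup xs i ∈ ys
  ∈ys i = xs⊆ys (∈-lookup i)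
  pos : Fin (length xs) → Fin (length ys)
  pos i = index (∈ys i)

-- Walks, trails and cycles

module Walks {n : ℕ} (G : Graph n) where
  open Graph G

  snoc-walk : ∀ {x y z m} → Walk G x y m → y ~ z → Walk G x z (suc m)
  snoc-walk []      e = e ∷ []
  snoc-walk (f ∷ w) e = f ∷ snoc-walk w e

  reverse-walk : ∀ {x y m} → Walk G x y m → Walk G y x m
  reverse-walk []      = []
  reverse-walk (e ∷ w) = snoc-walk (reverse-walk w) (~-sym e)

  _++ʷ_ : ∀ {x y z i j} → Walk G x y i → Walk G y z j → Walk G x z (i + j)
  []      ++ʷ w′ = w′
  (e ∷ w) ++ʷ w′ = e ∷ (w ++ʷ w′)

  -- Unlike `Walk`, this keeps the list of visited vertices, so that their distinctness can be
  -- expressed when a cycle is closed.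
  data Trail : Fin n → Fin n → List (Fin n) → Set where
    [-] : ∀ {x} → Trail x x (x ∷ [])
    _∷_ : ∀ {x y z vs} → x ~ y → Trail y z vs → Trail x z (x ∷ vs)

  trail-∷ʳ : ∀ {x y z vs} → Trail x y vs → y ~ z → Trail x z (vs ∷ʳ z)
  trail-∷ʳ [-]     e = e ∷ [-]
  trail-∷ʳ (f ∷ p) e = f ∷ trail-∷ʳ p e

  trail-step : ∀ {x y v vs} → Trail x y (v ∷ vs) →
    ∀ i → lookup (v ∷ vs) (inject₁ i) ~ lookup (v ∷ vs) (suc i)
  trail-step (e ∷ [-])     zero    = e
  trail-step (e ∷ (_ ∷ _)) zero    = e
  trail-step (e ∷ p@(_ ∷ _)) (suc i) = trail-step p i

  trail-last : ∀ {x y v vs} → Trail x y (v ∷ vs) → lookup (v ∷ vs) (fromℕ (length vs)) ≡ y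
  trail-last [-]             = refl
  trail-last (_ ∷ [-])       = refl
  trail-last (_ ∷ p@(_ ∷ _)) = trail-last p

  -- Three vertices are exposed because `IsCycle` describes cycles of length `3 + m`.
  trail-cycle : ∀ {x y v₀ v₁ v₂ vs} → Trail x y (v₀ ∷ v₁ ∷ v₂ ∷ vs) → Unique (v₀ ∷ v₁ ∷ v₂ ∷ vs) →
    y ~ x → ∃₂ (IsCycle G)
  trail-cycle {v₀ = v₀} {v₁} {v₂} {vs} p@(_ ∷ _) vs! e = length vs , lookup (v₀ ∷ v₁ ∷ v₂ ∷ vs) ,
    lookup-injective vs! , trail-step p , subst (_~ _) (sym (trail-last p)) e

-- Distances in a tree

module Metric {n : ℕ} (T : Tree n) where
  open Tree T
  open Walks graph

  -- Unfolding the search for a shortest walk makes conversion checking infeasible.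
  opaque
    dist : Fin n → Fin n → ℕ
    dist = d T

    geodesic : ∀ x y → Walk graph x y (dist x y)
    geodesic x y = proj₁ (proj₂ (shortest T x y))

    d-min : ∀ {x y m} → Walk graph x y m → dist x y ≤ m
    d-min {x} {y} w = proj₂ (proj₂ (shortest T x y)) _ w

  d-refl : ∀ x → dist x x ≡ 0
  d-refl x = n≤0⇒n≡0 (d-min [])

  d≡0⇒≡ : ∀ {x y} → dist x y ≡ 0 → x ≡ y
  d≡0⇒≡ {x} {y} eq with [] ← subst (Walk graph x y) eq (geodesic x y) = refl

  d-sym : ∀ x y → dist x y ≡ dist y x
  d-sym x y = ≤-antisym (d-min (reverse-walk (geodesic y x)))
                        (d-min (reverse-walk (geodesic x y)))

  d-triangle : ∀ x y z → dist x z ≤ dist x y + dist y z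
  d-triangle x y z = d-min (geodesic x y ++ʷ geodesic y z)

  ~⇒≢ : ∀ {x y} → x ~ y → x ≢ y
  ~⇒≢ e refl = ~-irrefl refl e

  d-~ : ∀ {x y} v → x ~ y → dist x v ≤ suc (dist y v)
  d-~ {x} {y} v e = d-min (e ∷ geodesic y v)

  d-~′ : ∀ {x y} v → x ~ y → dist v x ≤ suc (dist v y)
  d-~′ {x} {y} v e = subst₂ (λ i j → i ≤ suc j) (d-sym x v) (d-sym y v) (d-~ v e)

  ~⇒d≡1 : ∀ {x y} → x ~ y → dist x y ≡ 1
  ~⇒d≡1 {x} {y} e = ≤-antisym (d-min (e ∷ [])) (n≢0⇒n>0 (~⇒≢ e ∘ d≡0⇒≡))

  -- v lies beyond the edge x ~ y, seen from x.
  Branch : Fin n → Fin n → Fin n → Set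
  Branch x y v = x ~ y × suc (dist y v) ≡ dist x v

  opaque
    -- `y` is the second vertex of a shortest walk from `x` to `v`.
    toward-suc : ∀ {x v m} → dist x v ≡ suc m → ∃ λ y → Branch x y v
    toward-suc {x} {v} {m} eq with subst (Walk graph x v) eq (geodesic x v)
    ... | _∷_ {y = y} e w = y , e , ≤-antisym
            (subst (suc (dist y v) ≤_) (sym eq) (s≤s (d-min w))) (d-~ v e)

  opaque
    toward : ∀ {x v} → x ≢ v → ∃ λ y → Branch x y v
    toward {x} {v} x≢v with dist x v in eq
    ... | zero  = contradiction (d≡0⇒≡ eq) x≢v
    ... | suc m = let y , e , p = toward-suc eq in y , e , trans p eq

  -- Descending towards v from both ends of the trail either closes it to a
  -- cycle or yields a longer such trail one level closer to v.
  no-valley : ∀ v L {p q vs} → Trail p q vs → Unique vs → p ≢ q →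
    All (λ x → L ≤ dist x v) vs → dist p v ≡ L → ¬ dist q v ≡ L
  no-valley v zero _ _ p≢q _ pL qL = p≢q (trans (d≡0⇒≡ pL) (sym (d≡0⇒≡ qL)))
  no-valley v (suc L) [-] _ p≢q _ _ _ = p≢q refl
  no-valley v (suc L) {p} {q} {vs} t@(_ ∷ _) vs! p≢q ≥L pL qL
    with toward-suc pL | toward-suc qL
  ... | p′ , p~p′ , p′< | q′ , q~q′ , q′< = by-cases (p′ Fin.≟ q′)
    where
    below : ∀ {x y} → suc (dist y v) ≡ dist x v → dist x v ≡ suc L → ∀ {z} → suc L ≤ dist z v → y ≢ z
    below y< xL L≤ refl = 1+n≰n (≤-trans L≤ (≤-reflexive (suc-injective (trans y< xL))))
    close : ∀ {vs} → Trail p q vs → Unique vs → All (p′ ≢_) vs → p′ ≡ q′ → ∃₂ (IsCycle graph)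
    close [-] _ _ _ = contradiction refl p≢q
    close t@(_ ∷ [-]) vs! p′∉ refl = trail-cycle (~-sym p~p′ ∷ t) (p′∉ ∷ vs!) q~q′
    close t@(_ ∷ (_ ∷ _)) vs! p′∉ refl = trail-cycle (~-sym p~p′ ∷ t) (p′∉ ∷ vs!) q~q′
    by-cases : Dec (p′ ≡ q′) → ⊥
    by-cases (yes eq) = acyclic (close t vs! (All.map (below p′< pL) ≥L) eq)
    -- Both new ends are at level `L`, below every vertex of the old trail, so the longer trail has
    -- no repetition either.
    by-cases (no p′≢q′) = no-valley v L (~-sym p~p′ ∷ trail-∷ʳ t q~q′)
      (All.∷ʳ⁺ (All.map (below p′< pL) ≥L) p′≢q′
        ∷ Unique.++⁺ vs! ([] ∷ []) λ { (z∈ , here refl) → below q′< qL (All.lookup ≥L z∈) refl })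
      p′≢q′
      (≤-reflexive (sym p′L) ∷ All.∷ʳ⁺ (All.map <⇒≤ ≥L) (≤-reflexive (sym q′L)))
      p′L q′L
      where
      p′L = suc-injective (trans p′< pL)
      q′L = suc-injective (trans q′< qL)

  -- A tree is bipartite: with equal distances the edge itself would be a trail excluded by
  -- `no-valley`.
  ~-levels : ∀ v {x y} → x ~ y → suc (dist y v) ≡ dist x v ⊎ suc (dist x v) ≡ dist y v
  ~-levels v {x} {y} e with <-cmp (dist x v) (dist y v)
  ... | tri< x<y _ _ = inj₂ (≤-antisym x<y (d-~ v (~-sym e)))
  ... | tri> _ _ y<x = inj₁ (≤-antisym y<x (d-~ v e))
  ... | tri≈ _ x≡y _ = contradiction (sym x≡y)
    (no-valley v (dist x v) (e ∷ [-]) ((~⇒≢ e ∷ []) ∷ [] ∷ []) (~⇒≢ e)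
      (≤-refl ∷ ≤-reflexive x≡y ∷ []) refl)

  -- Two different neighbours of `x` towards `v` would be the ends of a trail through `x` excluded
  -- by `no-valley`.
  branch-unique : ∀ {v x y z} → Branch x y v → Branch x z v → y ≡ z
  branch-unique {v} {x} {y} {z} (e , y<) (f , z<) with y Fin.≟ z
  ... | yes y≡z = y≡z
  ... | no  y≢z = contradiction (suc-injective (trans z< (sym y<)))
    (no-valley v (dist y v) (~-sym e ∷ f ∷ [-])
      ((~⇒≢ (~-sym e) ∷ y≢z ∷ []) ∷ (~⇒≢ f ∷ []) ∷ [] ∷ []) y≢z
      (≤-refl ∷ ≤-trans (n≤1+n _) (≤-reflexive y<) ∷ ≤-reflexive (suc-injective (trans y< (sym z<))) ∷ []) refl)

-- Branches and midpoints

module Branches {n : ℕ} (T : Tree n) where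
  open Tree T
  open Metric T

  branch? : ∀ m a v → Dec (Branch m a v)
  branch? m a v = (m ~? a) ×-dec (suc (dist a v) ≟ dist m v)

  outside : ∀ {m a v} → m ~ a → ¬ Branch m a v → suc (dist m v) ≡ dist a v
  outside {v = v} m~a ∉ with ~-levels v m~a
  ... | inj₁ eq = contradiction (m~a , eq) ∉
  ... | inj₂ eq = eq

  branch-≢ : ∀ {m a v} → Branch m a v → v ≢ m
  branch-≢ {m} (_ , eq) refl = case trans eq (d-refl m) of λ ()

  branch-tip : ∀ {m a} → m ~ a → Branch m a a
  branch-tip {m} {a} m~a = m~a , trans (cong suc (d-refl a)) (sym (~⇒d≡1 m~a))

  branch-of-≤ : ∀ {m a v} → m ~ a → dist a v < dist m v → Branch m a v
  branch-of-≤ {v = v} m~a lt = m~a , ≤-antisym lt (d-~ v m~a)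

  -- The path from x to z enters the branch along m ~ a, the only edge leaving it.
  crossing : ∀ {m a z x} → Branch m a z → ¬ Branch m a x → dist x z ≡ dist x m + dist m z
  crossing {m} {a} {z} {x} z∈@(m~a , az<mz) x∉ = go _ x refl x∉
    where
    go : ∀ k x → dist x m ≡ k → ¬ Branch m a x → dist x z ≡ k + dist m z
    go zero x xm _ = cong (λ x → dist x z) (d≡0⇒≡ xm)
    go (suc k) x xm x∉ with toward-suc xm
    ... | y , x~y , ym<xm = by-level (~-levels z x~y)
      where
      ym : dist y m ≡ k
      ym = suc-injective (trans ym<xm xm)
      -- If `y` were in the branch and `x` not, then `x` and `y` would differ too much in their
      -- distances from `a` to be adjacent.
      y∉ : ¬ Branch m a y
      y∉ (_ , ay<my) = 1+n≰n (begin
        suc (dist x m) ≡⟨ cong suc (d-sym x m) ⟩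
        suc (dist m x) ≡⟨ outside m~a x∉ ⟩
        dist a x       ≤⟨ d-~′ a x~y ⟩
        suc (dist a y) ≡⟨ ay<my ⟩
        dist m y       ≡⟨ trans (d-sym m y) ym ⟩
        k              ≤⟨ n≤1+n k ⟩
        suc k          ≡⟨ xm ⟨
        dist x m       ∎)
        where open ≤-Reasoning
      yz : dist y z ≡ k + dist m z
      yz = go k y ym y∉
      -- If `y` is `m`, then `x` would be `a`. Otherwise the neighbour of `y` towards `m` is also
      -- its neighbour towards `z`, hence would be `x`, which is farther from `m` than `y`.
      no-turn : ∀ {k} → dist x m ≡ suc k → dist y m ≡ k → dist y z ≡ k + dist m z → ¬ Branch y x z
      no-turn {zero} xm ym _ x-near with refl ← d≡0⇒≡ ym with refl ← branch-unique x-near z∈ =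
        x∉ (branch-tip m~a)
      no-turn {suc k} xm ym yz x-near with toward-suc ym
      ... | y′ , y~y′ , y′m<ym = case
        trans (sym xm) (trans (cong (λ x → dist x m) (branch-unique x-near y′-near)) y′m) of
          λ eq → m≢1+n+m k {1} (sym eq)
        where
        y′m : dist y′ m ≡ k
        y′m = suc-injective (trans y′m<ym ym)
        y′-near : Branch y y′ z
        y′-near = branch-of-≤ y~y′ (begin
          suc (dist y′ z)            ≤⟨ s≤s (d-triangle y′ m z) ⟩
          suc (dist y′ m + dist m z) ≡⟨ cong (λ i → suc (i + dist m z)) y′m ⟩
          suc k + dist m z           ≡⟨ yz ⟨
          dist y z                   ∎)
          where open ≤-Reasoning
      by-level : suc (dist y z) ≡ dist x z ⊎ suc (dist x z) ≡ dist y z → dist x z ≡ suc k + dist m z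
      by-level (inj₁ eq) = trans (sym eq) (cong suc yz)
      by-level (inj₂ eq) = contradiction (~-sym x~y , eq) (no-turn xm ym yz)

  -- m is the midpoint of the path between x and y.
  record Fork (x y : Fin n) : Set where
    field
      {m a b} : Fin n
      x∈a     : Branch m a x
      y∈b     : Branch m b y
      a≢b     : a ≢ b
      level   : dist m x ≡ dist m y

  fork-sym : ∀ {x y} → Fork x y → Fork y x
  fork-sym f = record { x∈a = y∈b ; y∈b = x∈a ; a≢b = a≢b ∘ sym ; level = sym level }
    where open Fork f

  module _ {x y : Fin n} (f : Fork x y) where
    open Fork f

    branches-disjoint : ∀ {v} → Branch m a v → ¬ Branch m b v
    branches-disjoint v∈a v∈b = a≢b (branch-unique v∈a v∈b)

    far-side : ∀ {v} → ¬ Branch m b v → dist y v ≡ dist m x + dist m v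
    far-side {v} v∉b = begin
      dist y v            ≡⟨ d-sym y v ⟩
      dist v y            ≡⟨ crossing y∈b v∉b ⟩
      dist v m + dist m y ≡⟨ cong₂ _+_ (d-sym v m) (sym level) ⟩
      dist m v + dist m x ≡⟨ +-comm (dist m v) (dist m x) ⟩
      dist m x + dist m v ∎
      where open ≡-Reasoning

    -- Both `x` and `v` lie beyond the edge `m ~ a`, so going through `a` instead of `m` saves this
    -- edge twice.
    near-side : ∀ {v} → Branch m a v → suc (dist x v) < dist m x + dist m v
    near-side {v} (m~a , av<mv) = begin
      2 + dist x v                      ≤⟨ +-monoʳ-≤ 2 (d-triangle x a v) ⟩
      2 + (dist x a + dist a v)         ≡⟨ cong suc (+-suc (dist x a) (dist a v)) ⟨
      suc (dist x a) + suc (dist a v)   ≡⟨ cong₂ _+_ (trans (cong suc (d-sym x a)) (proj₂ x∈a)) av<mv ⟩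
      dist m x + dist m v               ∎
      where open ≤-Reasoning

    side-closer : ∀ {v} → Branch m a v → dist x v < dist y v
    side-closer v∈a = ≤-trans (n≤1+n _) (≤-trans (near-side v∈a)
      (≤-reflexive (sym (far-side (branches-disjoint v∈a)))))

  opaque
    -- Both vertices move towards `v` one step at a time until they meet, at the midpoint `m`. The
    -- recursion also records that `v` is in neither branch at `m`; this ensures that the step back
    -- from `x′` to `x` leads away from `m`.
    fork : ∀ {x y v} → x ≢ y → dist x v ≡ dist y v → Fork x y
    fork {v = v} x≢y eq = proj₁ (go _ x≢y refl (sym eq))
      where
      go : ∀ k {x y} → x ≢ y → dist x v ≡ k → dist y v ≡ k →
        ∃ λ (f : Fork x y) → ¬ Branch (Fork.m f) (Fork.a f) v × ¬ Branch (Fork.m f) (Fork.b f) v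
      go zero x≢y xv yv = contradiction (trans (d≡0⇒≡ xv) (sym (d≡0⇒≡ yv))) x≢y
      go (suc k) {x} {y} x≢y xv yv with toward-suc xv | toward-suc yv
      ... | x′ , x~x′ , x′< | y′ , y~y′ , y′< with x′ Fin.≟ y′
      ...   | yes refl = record
          { x∈a = branch-tip (~-sym x~x′) ; y∈b = branch-tip (~-sym y~y′) ; a≢b = x≢y
          ; level = trans (~⇒d≡1 (~-sym x~x′)) (sym (~⇒d≡1 (~-sym y~y′))) }
          , (λ (_ , <v) → 1+n≰n (≤-trans (s≤s (n≤1+n _)) (≤-reflexive (trans (cong suc x′<) <v))))
          , (λ (_ , <v) → 1+n≰n (≤-trans (s≤s (n≤1+n _)) (≤-reflexive (trans (cong suc y′<) <v))))
      ...   | no x′≢y′ with go k x′≢y′ (suc-injective (trans x′< xv)) (suc-injective (trans y′< yv))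
      ...     | f , v∉a , v∉b = record
          { x∈a = proj₁ mx ; y∈b = proj₁ my ; a≢b = a≢b
          ; level = trans (proj₂ mx) (trans (cong suc level) (sym (proj₂ my))) }
          , v∉a , v∉b
        where
        open Fork f
        lift : ∀ {x x′ a} → x ~ x′ → suc (dist x′ v) ≡ dist x v → Branch m a x′ → ¬ Branch m a v →
          Branch m a x × dist m x ≡ suc (dist m x′)
        lift {x} {x′} {a} x~x′ x′< (m~a , a<) v∉a =
          branch-of-≤ m~a (begin
            suc (dist a x)  ≤⟨ s≤s (d-~′ a x~x′) ⟩
            2 + dist a x′   ≡⟨ cong suc a< ⟩
            suc (dist m x′) ≡⟨ mx ⟨
            dist m x        ∎)
          , mx
          where
          open ≤-Reasoning
          mx : dist m x ≡ suc (dist m x′)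
          mx = ≤-antisym (d-~′ m x~x′) (+-cancelˡ-≤ (dist v m) _ _ (begin
            dist v m + suc (dist m x′)  ≡⟨ +-suc (dist v m) (dist m x′) ⟩
            suc (dist v m + dist m x′)  ≡⟨ cong suc (crossing (m~a , a<) v∉a) ⟨
            suc (dist v x′)             ≡⟨ cong suc (d-sym v x′) ⟩
            suc (dist x′ v)             ≡⟨ x′< ⟩
            dist x v                    ≡⟨ d-sym x v ⟩
            dist v x                    ≤⟨ d-triangle v m x ⟩
            dist v m + dist m x         ∎))
        mx : Branch m a x × dist m x ≡ suc (dist m x′)
        mx = lift x~x′ x′< x∈a v∉a
        my : Branch m b y × dist m y ≡ suc (dist m y′)
        my = lift y~y′ y′< y∈b v∉b

-- Major vertices, hubs and legs

farthest : ∀ {n} {P : Pred (Fin n) 0ℓ} → Decidable P → (f : Fin n → ℕ) → ∃ P →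
  ∃ λ x → P x × (∀ y → P y → f y ≤ f x)
farthest {n} P? f (x , px) = argmax f x xs
  , argmax-all f px (All.all-filter P? (allFin n))
  , λ y py → All.lookup (f[xs]≤f[argmax] x xs) (∈-filter⁺ P? (∈-allFin y) py)
  where xs = filter P? (allFin n)

module Legs {n : ℕ} (T : Tree n) where
  open Tree T
  open Metric T
  open Branches T

  three-neighbours : ∀ {v a b c} → v ~ a → v ~ b → v ~ c → a ≢ b → a ≢ c → b ≢ c → Major T v
  three-neighbours {v} {a} {b} {c} va vb vc a≢b a≢c b≢c =
    unique-⊆-length ((a≢b ∷ a≢c ∷ []) ∷ (b≢c ∷ []) ∷ [] ∷ []) λ
      { (here refl)                 → ∈-filter⁺ (v ~?_) (∈-allFin _) va
      ; (there (here refl))         → ∈-filter⁺ (v ~?_) (∈-allFin _) vb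
      ; (there (there (here refl))) → ∈-filter⁺ (v ~?_) (∈-allFin _) vc }

  opaque
    third-neighbour : ∀ {v} → Major T v → ∀ a b → ∃ λ c → v ~ c × c ≢ a × c ≢ b
    third-neighbour {v} major a b
      with Fin.any? (λ c → (v ~? c) ×-dec ¬? (c Fin.≟ a) ×-dec ¬? (c Fin.≟ b))
    ... | yes c = c
    ... | no ¬c = contradiction
      (≤-trans major (unique-⊆-length {ys = a ∷ b ∷ []} (Unique.filter⁺ (v ~?_) (Unique.allFin⁺ n)) covered))
      1+n≰n
      where
      covered : ∀ {c} → c ∈ filter (v ~?_) (allFin n) → c ∈ a ∷ b ∷ []
      covered {c} c∈ with c Fin.≟ a | c Fin.≟ b
      ... | yes refl | _        = here refl
      ... | no _     | yes refl = there (here refl)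
      ... | no c≢a   | no c≢b   = contradiction (c , proj₂ (∈-filter⁻ (v ~?_) {xs = allFin n} c∈) , c≢a , c≢b) ¬c

  end-neighbour : ∀ {u a b} → End T u → u ~ a → u ~ b → a ≡ b
  end-neighbour {u} {a} {b} end ua ub with a Fin.≟ b
  ... | yes a≡b = a≡b
  ... | no  a≢b = contradiction (subst (2 ≤_) end (unique-⊆-length ((a≢b ∷ []) ∷ [] ∷ []) λ
      { (here refl)         → ∈-filter⁺ (u ~?_) (∈-allFin _) ua
      ; (there (here refl)) → ∈-filter⁺ (u ~?_) (∈-allFin _) ub })) 1+n≰n

  sole-neighbour : ∀ {u a} → u ~ a → (∀ {b} → u ~ b → b ≡ a) → End T u
  sole-neighbour {u} {a} ua only = ≤-antisym
    (unique-⊆-length {ys = a ∷ []} (Unique.filter⁺ (u ~?_) (Unique.allFin⁺ n))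
      λ b∈ → here (only (proj₂ (∈-filter⁻ (u ~?_) {xs = allFin n} b∈))))
    (∈-length (∈-filter⁺ (u ~?_) (∈-allFin a) ua))

  -- `TerminalOf` with the opaque `dist` in place of `d`.
  Terminal : Fin n → Fin n → Set
  Terminal w u = End T u × Major T w × (∀ z → Major T z → z ≢ w → dist u w < dist u z)

  opaque
    unfolding dist

    terminal⁺ : ∀ {w u} → Terminal w u → u ∈ U T w
    terminal⁺ {w} t = ∈-filter⁺ (terminalOf? T w) (∈-allFin _) t

    terminal⁻ : ∀ {w u} → u ∈ U T w → Terminal w u
    terminal⁻ {w} u∈ = proj₂ (∈-filter⁻ (terminalOf? T w) {xs = allFin n} u∈)

  terminal-≢ : ∀ {w u} → Terminal w u → w ≢ u
  terminal-≢ (end , major , _) refl = contradiction (subst (3 ≤_) end major) λ { (s≤s ()) }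

  opaque
    -- A vertex `u` of the branch farthest from `v` has no neighbour farther still, hence only the
    -- one towards `v`. All other major vertices lie outside the branch and reach `u` through `v`.
    leg-terminal : ∀ {v c} → Major T v → v ~ c → (∀ z → Branch v c z → ¬ Major T z) →
      ∃ λ u → Branch v c u × Terminal v u
    leg-terminal {v} {c} major v~c bare
      with farthest (branch? v c) (dist v) (c , branch-tip v~c)
    ... | u , u∈@(_ , cu<vu) , u-max with toward (branch-≢ u∈)
    ... | p , u~p , pv<uv = u , u∈ , sole-neighbour u~p only , major , nearest
      where
      only : ∀ {b} → u ~ b → b ≡ p
      only {b} u~b with ~-levels v u~b
      ... | inj₁ bv<uv = branch-unique (u~b , bv<uv) (u~p , pv<uv)
      ... | inj₂ uv<bv = contradiction (u-max b (branch-of-≤ v~c (begin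
          suc (dist c b)  ≤⟨ s≤s (d-~′ c (~-sym u~b)) ⟩
          2 + dist c u    ≡⟨ cong suc cu<vu ⟩
          suc (dist v u)  ≡⟨ vu<vb ⟩
          dist v b        ∎))) (<⇒≱ (≤-reflexive vu<vb))
        where
        open ≤-Reasoning
        vu<vb : suc (dist v u) ≡ dist v b
        vu<vb = trans (cong suc (d-sym v u)) (trans uv<bv (d-sym b v))
      nearest : ∀ z → Major T z → z ≢ v → dist u v < dist u z
      nearest z z-major z≢v = begin-strict
        dist u v             ≡⟨ d-sym u v ⟩
        dist v u             <⟨ +-monoˡ-≤ (dist v u) (n≢0⇒n>0 (z≢v ∘ d≡0⇒≡)) ⟩
        dist z v + dist v u  ≡⟨ crossing u∈ (λ z∈ → bare z z∈ z-major) ⟨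
        dist z u             ≡⟨ d-sym z u ⟩
        dist u z             ∎
        where open ≤-Reasoning

  record Hub (w : Fin n) : Set where
    constructor mk-hub
    field
      major  : Major T w
      forked : 1 < ter T w

  hub? : Decidable Hub
  hub? w = map′ (λ (m , f) → mk-hub m f) (λ (mk-hub m f) → m , f) (major? T w ×-dec (1 <? ter T w))

  hub-of-terminals : ∀ {w u u′} → Terminal w u → Terminal w u′ → u ≢ u′ → Hub w
  hub-of-terminals t@(_ , major , _) t′ u≢u′ = mk-hub major (unique-⊆-length ((u≢u′ ∷ []) ∷ [] ∷ []) λ
    { (here refl)         → terminal⁺ t
    ; (there (here refl)) → terminal⁺ t′ })

  -- The path from `m` to `z` passes `v`, which already lies behind `a`.
  branch-trans : ∀ {m a v c z} → Branch m a v → ¬ Branch v c m → Branch v c z → Branch m a z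
  branch-trans {m} {a} {v} {c} {z} (m~a , av<mv) m∉ z∈ = branch-of-≤ m~a (begin
    suc (dist a z)               ≤⟨ s≤s (d-triangle a v z) ⟩
    suc (dist a v) + dist v z    ≡⟨ cong (_+ dist v z) av<mv ⟩
    dist m v + dist v z          ≡⟨ crossing z∈ m∉ ⟨
    dist m z                     ∎)
    where open ≤-Reasoning

  opaque
    -- Take a major vertex `v` of the branch farthest from `m`. Two of its neighbours, `c` and `c′`,
    -- do not lead to `m`; no major vertex lies behind them, so each leads to a terminal vertex of
    -- `v`.
    hub-in-branch : ∀ {m a z} → Branch m a z → Major T z → ∃ λ w → Branch m a w × Hub w
    hub-in-branch {m} {a} {z} z∈ z-major
      with farthest (λ v → branch? m a v ×-dec major? T v) (dist m) (z , z∈ , z-major)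
    ... | v , (v∈ , v-major) , v-max with toward (branch-≢ v∈)
    ... | p , m∈p with third-neighbour v-major p p
    ...   | c , v~c , c≢p , _ with third-neighbour v-major p c
    ...     | c′ , v~c′ , c′≢p , c′≢c with leg-terminal v-major v~c (bare c≢p) | leg-terminal v-major v~c′ (bare c′≢p)
      where
      bare : ∀ {c} → c ≢ p → ∀ z → Branch v c z → ¬ Major T z
      bare {c} c≢p z z∈c z-major = 1+n≰n (begin
        suc (dist m v)        ≡⟨ +-comm 1 (dist m v) ⟩
        dist m v + 1          ≤⟨ +-monoʳ-≤ (dist m v) (n≢0⇒n>0 (branch-≢ z∈c ∘ sym ∘ d≡0⇒≡)) ⟩
        dist m v + dist v z   ≡⟨ crossing z∈c m∉c ⟨
        dist m z              ≤⟨ v-max z (branch-trans v∈ m∉c z∈c , z-major) ⟩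
        dist m v              ∎)
        where
        open ≤-Reasoning
        m∉c : ¬ Branch v c m
        m∉c m∈c = c≢p (branch-unique m∈c m∈p)
    ...       | u , u∈c , t | u′ , u′∈c′ , t′ =
      v , v∈ , hub-of-terminals t t′ λ { refl → c′≢c (branch-unique u′∈c′ u∈c) }

  hub-or-terminal : ∀ {v c} → Major T v → v ~ c →
    (∃ λ w → Branch v c w × Hub w) ⊎ (∃ λ u → Branch v c u × Terminal v u)
  hub-or-terminal {v} {c} major v~c with Fin.any? (λ w → branch? v c w ×-dec hub? w)
  ... | yes hub = inj₁ hub
  ... | no none = inj₂ (leg-terminal major v~c λ z z∈ z-major → none (hub-in-branch z∈ z-major))

  Between : Fin n → Fin n → Fin n → Set
  Between w z u = dist w z + dist z u ≡ dist w u

  between-step : ∀ {w z u p} → Between w z u → Branch z p w → Between w p u × Branch p z u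
  between-step {w} {z} {u} {p} btw (z~p , pw<zw) = wpu , ~-sym z~p , +-cancelˡ-≡ (dist w p) _ _ (begin
      dist w p + suc (dist z u) ≡⟨ shift ⟩
      dist w u                  ≡⟨ wpu ⟨
      dist w p + dist p u       ∎)
    where
    open ≡-Reasoning
    wp<wz : suc (dist w p) ≡ dist w z
    wp<wz = trans (cong suc (d-sym w p)) (trans pw<zw (d-sym z w))
    shift : dist w p + suc (dist z u) ≡ dist w u
    shift = trans (+-suc (dist w p) (dist z u)) (trans (cong (_+ dist z u) wp<wz) btw)
    wpu : Between w p u
    wpu = ≤-antisym (≤-trans (+-monoʳ-≤ (dist w p) (d-~ u (~-sym z~p))) (≤-reflexive shift)) (d-triangle w p u)

  -- By induction on the distance from `w` the predecessors of `z` and `z′` coincide, and both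
  -- vertices are the neighbour of the predecessor towards `u`.
  between-unique : ∀ {w u z z′} → Between w z u → Between w z′ u → dist w z ≡ dist w z′ → z ≡ z′
  between-unique {w} {u} btw btw′ eq =
    go _ btw btw′ (trans (d-sym _ w) eq) (d-sym _ w)
    where
    go : ∀ k {z z′} → Between w z u → Between w z′ u → dist z w ≡ k → dist z′ w ≡ k → z ≡ z′
    go zero _ _ zw z′w = trans (d≡0⇒≡ zw) (sym (d≡0⇒≡ z′w))
    go (suc k) btw btw′ zw z′w with toward-suc zw | toward-suc z′w
    ... | p , z∈ | p′ , z′∈ with between-step btw z∈ | between-step btw′ z′∈
    ...   | b , u∈ | b′ , u∈′
      with refl ← go k b b′ (suc-injective (trans (proj₂ z∈) zw)) (suc-injective (trans (proj₂ z′∈) z′w)) =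
        branch-unique u∈ u∈′

  opaque
    between-point : ∀ w u p → p ≤ dist w u → ∃ λ z → dist w z ≡ p × Between w z u
    between-point w u zero _ = w , d-refl w , cong (_+ dist w u) (d-refl w)
    between-point w u (suc p) p<wu with between-point w u p (<⇒≤ p<wu)
    ... | z , wz , btw with toward {z} {u} (λ { refl → 1+n≰n (subst (suc p ≤_) wz p<wu) })
    ...   | s , z~s , su<zu = s , ws , trans (cong (_+ dist s u) ws) rest
      where
      open ≤-Reasoning
      rest : suc p + dist s u ≡ dist w u
      rest = trans (sym (+-suc p (dist s u))) (trans (cong₂ _+_ (sym wz) su<zu) btw)
      ws : dist w s ≡ suc p
      ws = ≤-antisym (≤-trans (d-~′ w (~-sym z~s)) (≤-reflexive (cong suc wz)))
        (+-cancelʳ-≤ (dist s u) (suc p) (dist w s) (≤-trans (≤-reflexive rest) (d-triangle w s u)))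

  -- The base `w` is left out and the end `u` is included, which makes different legs disjoint.
  OnLeg : Fin n → Fin n → Fin n → Set
  OnLeg w u z = z ≢ w × Between w z u

  on-leg? : ∀ w u z → Dec (OnLeg w u z)
  on-leg? w u z = ¬? (z Fin.≟ w) ×-dec (dist w z + dist z u ≟ dist w u)

  -- Otherwise the path from `z` to `u` passes `w`, and betweenness leaves length 0 for the detour
  -- from `w` to `z` and back.
  on-leg⇒branch : ∀ {w u z c} → Branch w c u → OnLeg w u z → Branch w c z
  on-leg⇒branch {w} {u} {z} {c} u∈ (z≢w , btw) with branch? w c z
  ... | yes z∈ = z∈
  ... | no  z∉ = contradiction (sym (d≡0⇒≡ (m+n≡0⇒m≡0 (dist w z)
      (+-cancelʳ-≡ (dist w u) (dist w z + dist z w) 0 (begin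
        dist w z + dist z w + dist w u   ≡⟨ +-assoc (dist w z) (dist z w) (dist w u) ⟩
        dist w z + (dist z w + dist w u) ≡⟨ cong (dist w z +_) (crossing u∈ z∉) ⟨
        dist w z + dist z u              ≡⟨ btw ⟩
        dist w u                         ∎))))) z≢w
    where open ≡-Reasoning

  branch-leg : ∀ {w u z c} → Terminal w u → OnLeg w u z → Branch w c z → Branch w c u
  branch-leg {c = c} t on z∈c with toward (terminal-≢ t)
  ... | c′ , u∈c′ with refl ← branch-unique z∈c (on-leg⇒branch u∈c′ on) = u∈c′

  -- A major vertex on the leg would be at least as near to `u` as `w` is.
  leg-not-major : ∀ {w u z} → Terminal w u → OnLeg w u z → ¬ Major T z
  leg-not-major {w} {u} {z} (_ , _ , nearest) (z≢w , btw) major = <⇒≱ (nearest z major z≢w) (begin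
    dist u z            ≡⟨ d-sym u z ⟩
    dist z u            ≤⟨ m≤n+m (dist z u) (dist w z) ⟩
    dist w z + dist z u ≡⟨ btw ⟩
    dist w u            ≡⟨ d-sym w u ⟩
    dist u w            ∎)
    where open ≤-Reasoning

  -- Induction on the distance from `w`. The predecessor `p` of `z` is on the leg and not major, and
  -- it is not `u`, which has only one neighbour. So the neighbours of `p` are the one towards `w`
  -- and the one towards `u`, and `z` is the latter.
  branch⇒on-leg : ∀ {w u z c} → Terminal w u → Branch w c u → Branch w c z → OnLeg w u z
  branch⇒on-leg {w} {u} {z} {c} t@(end , _) u∈@(w~c , cu<wu) z∈ = branch-≢ z∈ , go _ refl z∈
    where
    go : ∀ k {z} → dist z w ≡ k → Branch w c z → Between w z u
    go zero zw z∈ = contradiction (d≡0⇒≡ zw) (branch-≢ z∈)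
    go (suc k) {z} zw z∈ with toward-suc zw
    ... | p , z~p , pw<zw with p Fin.≟ w
    ...   | yes refl with refl ← branch-unique (branch-tip (~-sym z~p)) z∈ =
      trans (cong (_+ dist z u) (~⇒d≡1 w~c)) cu<wu
    ...   | no p≢w with branch? w c p
    -- Outside the branch, `p` could be reached from `z` only through `w`, at distance at least 2.
    ...     | no p∉ = contradiction
      (≤-trans (+-mono-≤ (n≢0⇒n>0 (p≢w ∘ d≡0⇒≡)) (n≢0⇒n>0 (branch-≢ z∈ ∘ sym ∘ d≡0⇒≡)))
        (≤-reflexive (trans (sym (crossing z∈ p∉)) (~⇒d≡1 (~-sym z~p))))) 1+n≰n
    ...     | yes p∈ = by-cases (toward p≢w) (toward p≢u)
      where
      pw : dist p w ≡ k
      pw = suc-injective (trans pw<zw zw)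
      btw : Between w p u
      btw = go k pw p∈
      back-≢ : ∀ {q} → Branch p q w → z ≢ q
      back-≢ (_ , qw<pw) refl = 1+n≰n (≤-trans (s≤s (n≤1+n _)) (≤-reflexive (trans (cong suc pw<zw) qw<pw)))
      p≢u : p ≢ u
      p≢u refl = let q , q-back = toward p≢w in back-≢ q-back (end-neighbour end (~-sym z~p) (proj₁ q-back))
      by-cases : (∃ λ q → Branch p q w) → (∃ λ s → Branch p s u) → Between w z u
      by-cases (q , q-back@(p~q , qw<pw)) (s , p~s , su<pu) with z Fin.≟ s
      ... | yes refl = begin
        dist w z + dist z u       ≡⟨ cong (_+ dist z u) (trans (d-sym w z) (trans (sym pw<zw) (cong suc (d-sym p w)))) ⟩
        suc (dist w p) + dist z u ≡⟨ +-suc (dist w p) (dist z u) ⟨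
        dist w p + suc (dist z u) ≡⟨ cong (dist w p +_) su<pu ⟩
        dist w p + dist p u       ≡⟨ btw ⟩
        dist w u                  ∎
        where open ≡-Reasoning
      ... | no z≢s = contradiction
        (three-neighbours (~-sym z~p) p~q p~s (back-≢ q-back) z≢s q≢s)
        (leg-not-major t (p≢w , btw))
        where
        open ≤-Reasoning
        q≢s : q ≢ s
        q≢s refl = 1+n≰n (begin
          suc (dist w u)                  ≤⟨ s≤s (d-triangle w q u) ⟩
          suc (dist w q) + dist q u       ≤⟨ +-monoʳ-≤ (suc (dist w q)) (n≤1+n (dist q u)) ⟩
          suc (dist w q) + suc (dist q u) ≡⟨ cong₂ _+_ (trans (cong suc (d-sym w q)) (trans qw<pw (d-sym p w))) su<pu ⟩
          dist w p + dist p u             ≡⟨ btw ⟩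
          dist w u                        ∎)

  -- The defining inequality at the end `u` passes to `z`: the way from `u` to `w` leads through
  -- `z`, and the distance from `u` to `v` is bounded by the triangle inequality.
  leg-nearest : ∀ {w u z v} → Terminal w u → OnLeg w u z → Major T v → v ≢ w → dist z w < dist z v
  leg-nearest {w} {u} {z} {v} (_ , _ , nearest) (_ , btw) major v≢w =
    +-cancelʳ-< (dist z u) (dist z w) (dist z v) (begin-strict
      dist z w + dist z u ≡⟨ cong (_+ dist z u) (d-sym z w) ⟩
      dist w z + dist z u ≡⟨ btw ⟩
      dist w u            ≡⟨ d-sym w u ⟩
      dist u w            <⟨ nearest v major v≢w ⟩
      dist u v            ≤⟨ d-triangle u z v ⟩
      dist u z + dist z v ≡⟨ cong (_+ dist z v) (d-sym u z) ⟩
      dist z u + dist z v ≡⟨ +-comm (dist z u) (dist z v) ⟩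
      dist z v + dist z u ∎)
    where open ≤-Reasoning

  -- By `leg-nearest`, each of two different bases would be strictly nearer to `z` than the other.
  leg-base-unique : ∀ {w w′ u u′ z} → Terminal w u → Terminal w′ u′ → OnLeg w u z → OnLeg w′ u′ z → w ≡ w′
  leg-base-unique {w} {w′} t@(_ , major , _) t′@(_ , major′ , _) on on′ with w Fin.≟ w′
  ... | yes w≡w′ = w≡w′
  ... | no  w≢w′ = contradiction (leg-nearest t′ on′ major w≢w′) (<-asym (leg-nearest t on major′ (w≢w′ ∘ sym)))

  -- Both legs leave `w` by the same edge, so each end lies on the leg of the other; going from `w`
  -- to `u′` by way of both ends then adds no length.
  leg-end-unique : ∀ {w u u′ z} → Terminal w u → Terminal w u′ → OnLeg w u z → OnLeg w u′ z → u ≡ u′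
  leg-end-unique {w} {u} {u′} t t′ on on′ with toward (terminal-≢ t) | toward (terminal-≢ t′)
  ... | c , u∈ | c′ , u′∈ with refl ← branch-unique (on-leg⇒branch u∈ on) (on-leg⇒branch u′∈ on′) =
    sym (d≡0⇒≡ (m+n≡0⇒m≡0 (dist u′ u) {dist u u′} (+-cancelˡ-≡ (dist w u′) _ 0 (begin
      dist w u′ + (dist u′ u + dist u u′) ≡⟨ +-assoc (dist w u′) (dist u′ u) (dist u u′) ⟨
      dist w u′ + dist u′ u + dist u u′   ≡⟨ cong (_+ dist u u′) (proj₂ (branch⇒on-leg t u∈ u′∈)) ⟩
      dist w u + dist u u′                ≡⟨ proj₂ (branch⇒on-leg t′ u′∈ u∈) ⟩
      dist w u′                           ≡⟨ +-identityʳ (dist w u′) ⟨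
      dist w u′ + 0                       ∎))))
    where open ≡-Reasoning

-- A tree without major vertices is a path

fin-injective⇒surjective : ∀ {n} {f : Fin n → Fin n} → Injective _≡_ _≡_ f → ∀ i → ∃ λ j → f j ≡ i
fin-injective⇒surjective {n} {f} f-inj i with Fin.any? (λ j → f j Fin.≟ i)
... | yes hit = hit
... | no miss = contradiction (Fin.injective⇒≤ extend-inj) 1+n≰n
  where
  extend : Fin (suc n) → Fin n
  extend zero    = i
  extend (suc j) = f j
  extend-inj : Injective _≡_ _≡_ extend
  extend-inj {zero}  {zero}  _  = refl
  extend-inj {zero}  {suc k} eq = contradiction (k , sym eq) miss
  extend-inj {suc j} {zero}  eq = contradiction (j , eq) miss
  extend-inj {suc j} {suc k} eq = cong suc (f-inj eq)

∣m-n∣≡1⇒ : ∀ m n → ∣ m - n ∣ ≡ 1 → suc m ≡ n ⊎ suc n ≡ m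
∣m-n∣≡1⇒ zero    n             eq = inj₁ (sym eq)
∣m-n∣≡1⇒ (suc m) zero          eq = inj₂ (sym eq)
∣m-n∣≡1⇒ (suc m) (suc n)       eq with ∣m-n∣≡1⇒ m n eq
... | inj₁ p = inj₁ (cong suc p)
... | inj₂ p = inj₂ (cong suc p)

∣n-1+n∣≡1 : ∀ n → ∣ n - suc n ∣ ≡ 1
∣n-1+n∣≡1 zero    = refl
∣n-1+n∣≡1 (suc n) = ∣n-1+n∣≡1 n

module _ {n : ℕ} (G : Graph n) where
  open Graph G

  path-of-numbering : (f : Fin n → ℕ) → (∀ x → f x < n) →
    (∀ {x y} → f x ≡ f y → x ≡ y) → (∀ x y → x ~ y ⇔ ∣ f x - f y ∣ ≡ 1) → IsPath G
  path-of-numbering f f< f-inj ~⇔ = permutation vertex position vertex-position position-vertex , λ i j →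
    subst₂ (λ p q → vertex i ~ vertex j ⇔ ∣ p - q ∣ ≡ 1) (f-vertex i) (f-vertex j) (~⇔ (vertex i) (vertex j))
    where
    position : Fin n → Fin n
    position x = fromℕ< (f< x)
    toℕ-position : ∀ x → toℕ (position x) ≡ f x
    toℕ-position x = Fin.toℕ-fromℕ< (f< x)
    position-injective : Injective _≡_ _≡_ position
    position-injective {x} {y} eq =
      f-inj (trans (sym (toℕ-position x)) (trans (cong toℕ eq) (toℕ-position y)))
    vertex : Fin n → Fin n
    vertex i = proj₁ (fin-injective⇒surjective position-injective i)
    position-vertex : ∀ i → position (vertex i) ≡ i
    position-vertex i = proj₂ (fin-injective⇒surjective position-injective i)
    vertex-position : ∀ x → vertex (position x) ≡ x
    vertex-position x = position-injective (position-vertex (position x))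
    f-vertex : ∀ i → f (vertex i) ≡ toℕ i
    f-vertex i = trans (sym (toℕ-position (vertex i))) (cong toℕ (position-vertex i))

module Paths {n : ℕ} (T : Tree n) where
  open Tree T
  open Metric T
  open Legs T

  -- The vertices on the path from `x` to `y` are told apart by their distances from `x`, which take
  -- `suc (dist x y)` values.
  dist< : ∀ x y → dist x y < n
  dist< x y = Fin.injective⇒≤ {f = point} λ {i} {j} eq →
    Fin.toℕ-injective (trans (sym (at i)) (trans (cong (dist x) eq) (at j)))
    where
    between : ∀ (i : Fin (suc (dist x y))) → ∃ λ z → dist x z ≡ toℕ i × Between x z y
    between i = between-point x y (toℕ i) (s≤s⁻¹ (Fin.toℕ<n i))
    point : Fin (suc (dist x y)) → Fin n
    point i = proj₁ (between i)
    at : ∀ i → dist x (point i) ≡ toℕ i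
    at i = proj₁ (proj₂ (between i))

  -- Vertices are numbered by their distance from `u`, a vertex farthest from an arbitrary `v₀`. All
  -- neighbours of `u` lead to `v₀`, so there is only one. Two vertices at the same level have a
  -- common predecessor by induction; if it is not `u`, it would have a third neighbour towards `u`
  -- and be major.
  path-of-no-major : (∀ v → ¬ Major T v) → IsPath graph
  path-of-no-major no-major = path-of-numbering graph (λ x → dist x u) (λ x → dist< x u)
    (λ eq → level-injective _ refl (sym eq)) λ x y → mk⇔
      (λ x~y → case ~-levels u x~y of λ where
        (inj₁ y<x) → trans (∣-∣-comm (dist x u) (dist y u)) (gap y<x)
        (inj₂ x<y) → gap x<y)
      (λ eq → case ∣m-n∣≡1⇒ (dist x u) (dist y u) eq of λ where
        (inj₁ x<y) → adjacent x<y
        (inj₂ y<x) → ~-sym (adjacent y<x))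
    where
    v₀ : Fin n
    v₀ = fromℕ< (≤-trans (s≤s z≤n) nontrivial)
    far : ∃ λ u → ⊤ × (∀ y → ⊤ → dist v₀ y ≤ dist v₀ u)
    far = farthest (λ _ → yes tt) (dist v₀) (v₀ , tt)
    u : Fin n
    u = proj₁ far
    back : ∀ {b} → u ~ b → Branch u b v₀
    back {b} u~b with ~-levels v₀ u~b
    ... | inj₁ b<u = u~b , b<u
    ... | inj₂ u<b = contradiction (proj₂ (proj₂ far) b tt)
      (<⇒≱ (≤-reflexive (trans (cong suc (d-sym v₀ u)) (trans u<b (d-sym b v₀)))))
    level-injective : ∀ k {x y} → dist x u ≡ k → dist y u ≡ k → x ≡ y
    level-injective zero xu yu = trans (d≡0⇒≡ xu) (sym (d≡0⇒≡ yu))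
    level-injective (suc k) {x} {y} xu yu with toward-suc xu | toward-suc yu
    ... | p , x~p , p<x | p′ , y~p′ , p′<y
      with refl ← level-injective k (suc-injective (trans p<x xu)) (suc-injective (trans p′<y yu))
      with p Fin.≟ u
    ...   | yes refl = branch-unique (back (~-sym x~p)) (back (~-sym y~p′))
    ...   | no p≢u with x Fin.≟ y
    ...     | yes x≡y = x≡y
    ...     | no  x≢y with toward p≢u
    ...       | q , p~q , q<p = contradiction
      (three-neighbours (~-sym x~p) (~-sym y~p′) p~q x≢y (below p<x) (below p′<y)) (no-major p)
      where
      below : ∀ {x} → suc (dist p u) ≡ dist x u → x ≢ q
      below {x} p<x refl = m≢1+n+m (dist x u) {1} (trans (sym p<x) (cong suc (sym q<p)))
    gap : ∀ {x y} → suc (dist x u) ≡ dist y u → ∣ dist x u - dist y u ∣ ≡ 1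
    gap {x} eq = trans (cong ∣ dist x u -_∣ (sym eq)) (∣n-1+n∣≡1 (dist x u))
    adjacent : ∀ {x y} → suc (dist x u) ≡ dist y u → x ~ y
    adjacent {x} {y} eq with toward-suc (sym eq)
    ... | p , y~p , p<y = subst (_~ y) (level-injective _ (suc-injective (trans p<y (sym eq))) refl) (~-sym y~p)

  some-major : ¬ IsPath graph → ∃ (Major T)
  some-major ¬path with Fin.any? (major? T)
  ... | yes major = major
  ... | no  none  = contradiction (path-of-no-major λ v major → none (v , major)) ¬path

-- Minima, leg lengths and distances to sets

minimum-≤ : ∀ {x xs} → x ∈ xs → minimum xs ≤ x
minimum-≤ {xs = y ∷ xs} (here refl) = min≤v⁺ y xs (inj₁ ≤-refl)
minimum-≤ {xs = y ∷ xs} (there x∈)  = min≤v⁺ y xs (inj₂ (Any.map (≤-reflexive ∘ sym) x∈))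

minimum-∈ : ∀ {x xs} → x ∈ xs → minimum xs ∈ xs
minimum-∈ {xs = y ∷ xs} _ with argmin-sel (λ z → z) y xs
... | inj₁ eq = here eq
... | inj₂ m∈ = there m∈

module _ {a} {A : Set a} (f : A → ℕ) where

  minimum-map-≤ : ∀ {x xs} → x ∈ xs → minimum (map f xs) ≤ f x
  minimum-map-≤ x∈ = minimum-≤ (∈-map⁺ f x∈)

  minimum-map-attained : ∀ {x xs} → x ∈ xs → ∃ λ y → y ∈ xs × minimum (map f xs) ≡ f y
  minimum-map-attained x∈ = ∈-map⁻ f (minimum-∈ (∈-map⁺ f x∈))

  -- One pass of bubble sort from the right: only the head has to be least.
  min-first : List A → List A
  min-cons : A → List A → List A
  min-first []       = []
  min-first (x ∷ xs) = min-cons x (min-first xs)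
  min-cons x []       = x ∷ []
  min-cons x (y ∷ ys) with f x ≤? f y
  ... | yes _ = x ∷ y ∷ ys
  ... | no  _ = y ∷ x ∷ ys

  min-first-↭ : ∀ xs → min-first xs ↭ xs
  min-first-↭ []       = ↭-refl
  min-first-↭ (x ∷ xs) = ↭-trans (cons (min-first xs)) (↭-prep x (min-first-↭ xs))
    where
    cons : ∀ ys → min-cons x ys ↭ x ∷ ys
    cons []       = ↭-refl
    cons (y ∷ ys) with f x ≤? f y
    ... | yes _ = ↭-refl
    ... | no  _ = ↭-swap y x ↭-refl

  -- The head is given as an index of value 0, the form in which leg number 0 occurs later.
  min-first-head : ∀ xs {y} → y ∈ xs → ∀ (i : Fin (length (min-first xs))) → toℕ i ≡ 0 →
    f (lookup (min-first xs) i) ≤ f y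
  min-first-head (x ∷ xs) = cons (min-first xs) (min-first-head xs) (∈-resp-↭ (↭-sym (min-first-↭ xs)))
    where
    cons : ∀ ys → (∀ {y} → y ∈ xs → ∀ (i : Fin (length ys)) → toℕ i ≡ 0 → f (lookup ys i) ≤ f y) →
      (∀ {y} → y ∈ xs → y ∈ ys) → ∀ {y} → y ∈ x ∷ xs →
      ∀ (i : Fin (length (min-cons x ys))) → toℕ i ≡ 0 → f (lookup (min-cons x ys) i) ≤ f y
    cons [] _ _    (here refl) zero _ = ≤-refl
    cons [] _ ⊆ys  (there y∈)  _    _ = case ⊆ys y∈ of λ ()
    cons (y ∷ ys) ih _ z∈ i i≡0 with f x ≤? f y
    cons (y ∷ ys) ih _ (here refl) zero _ | yes x≤y = ≤-refl
    cons (y ∷ ys) ih _ (there z∈)  zero _ | yes x≤y = ≤-trans x≤y (ih z∈ zero refl)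
    cons (y ∷ ys) ih _ (here refl) zero _ | no  x≰y = ≰⇒≥ x≰y
    cons (y ∷ ys) ih _ (there z∈)  zero _ | no  x≰y = ih z∈ zero refl

module Lengths {n : ℕ} (T : Tree n) where
  open Metric T
  open Legs T

  𝓜⁺ : ∀ {w} → Hub w → w ∈ 𝓜 T
  𝓜⁺ {w} (mk-hub major forked) = ∈-filter⁺ (λ v → major? T v ×-dec (1 <? ter T v)) (∈-allFin w) (major , forked)

  opaque
    unfolding dist

    ℓ : Fin n → ℕ
    ℓ = l-vertex T

    ℓ≡l-vertex : ∀ w → ℓ w ≡ l-vertex T w
    ℓ≡l-vertex w = refl

    ℓ-≤ : ∀ {w u} → Terminal w u → ℓ w ≤ dist u w
    ℓ-≤ {w} t = minimum-map-≤ (λ u → dist u w) (terminal⁺ t)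

    ℓ-attained : ∀ {w u} → Terminal w u → ∃ λ u′ → Terminal w u′ × ℓ w ≡ dist u′ w
    ℓ-attained {w} t with minimum-map-attained (λ u → dist u w) (terminal⁺ t)
    ... | u′ , u′∈ , eq = u′ , terminal⁻ u′∈ , eq

    ς-≤ : ∀ {w u u′} → Terminal w u → Terminal w u′ → u ≢ u′ → ς T ≤ dist u w + dist u′ w
    ς-≤ {w} t t′ u≢u′ = ≤-trans (minimum-map-≤ (ς-vertex T) (𝓜⁺ (hub-of-terminals t t′ u≢u′)))
      (minimum-map-≤ (uncurry (ς-pair T w)) (∈-filter⁺ (λ (u , v) → ¬? (u Fin.≟ v))
        (∈-cartesianProduct⁺ (terminal⁺ t) (terminal⁺ t′)) u≢u′))

    d-set-≤ : ∀ {x z S} → z ∈ₛ S → d-set T x S ≤ dist x z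
    d-set-≤ {x} {z} {S} z∈ = minimum-map-≤ (dist x) (∈-filter⁺ (_∈? S) (∈-allFin z) z∈)

    d-set-attained : ∀ {x z S} → z ∈ₛ S → ∃ λ z′ → z′ ∈ₛ S × d-set T x S ≡ dist x z′
    d-set-attained {x} {z} {S} z∈ with minimum-map-attained (dist x) (∈-filter⁺ (_∈? S) (∈-allFin z) z∈)
    ... | z′ , z′∈ , eq = z′ , proj₂ (∈-filter⁻ (_∈? S) {xs = allFin n} z′∈) , eq

  -- Applied to a member of `S` nearest to `y`, the hypothesis shows that `x` is strictly nearer to
  -- `S` than `y` is.
  distinguish : ∀ {x y z S} → z ∈ₛ S → (∀ {z} → z ∈ₛ S → ∃ λ z′ → z′ ∈ₛ S × dist x z′ < dist y z) →
    Distinguishes T x y S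
  distinguish {x} {y} {z} {S} z∈ closer with d-set-attained {y} z∈
  ... | y′ , y′∈ , eq with closer y′∈
  ...   | x′ , x′∈ , x′<y′ = <⇒≢ (≤-<-trans (d-set-≤ x′∈) (<-≤-trans x′<y′ (≤-reflexive (sym eq))))

  opaque
    legs : Fin n → List (Fin n)
    legs w = min-first (λ u → dist u w) (U T w)

    legs-length : ∀ w → length (legs w) ≡ ter T w
    legs-length w = ↭-length (min-first-↭ _ (U T w))

    legs-unique : ∀ w → Unique (legs w)
    legs-unique w = Permutationₛ.Unique-resp-↭ (setoid (Fin n)) (↭⇒↭ₛ (↭-sym (min-first-↭ _ (U T w))))
      (Unique.filter⁺ (terminalOf? T w) (Unique.allFin⁺ n))

    leg-index : ∀ {w u} → Terminal w u → ∃ λ (i : Fin (length (legs w))) → lookup (legs w) i ≡ u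
    leg-index {w} t = let u∈ = ∈-resp-↭ (↭-sym (min-first-↭ _ (U T w))) (terminal⁺ t) in
      index u∈ , sym (lookup-index u∈)

    leg-is-terminal : ∀ {w} (i : Fin (length (legs w))) → Terminal w (lookup (legs w) i)
    leg-is-terminal {w} i = terminal⁻ (∈-resp-↭ (min-first-↭ _ (U T w)) (∈-lookup i))

    first-leg : ∀ {w} (i : Fin (length (legs w))) → toℕ i ≡ 0 → dist (lookup (legs w) i) w ≤ ℓ w
    first-leg {w} i i≡0 with ℓ-attained (leg-is-terminal i)
    ... | u , t , eq = ≤-trans (min-first-head (λ u → dist u w) (U T w) (terminal⁺ t) i i≡0) (≤-reflexive (sym eq))

-- The colouring and its classes

separate : ∀ {n} {P : Pred (Fin n) 0ℓ} → Decidable P → Subset n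
separate P? = Vec.tabulate (does ∘ P?)

module _ {n : ℕ} {P : Pred (Fin n) 0ℓ} (P? : Decidable P) where

  separate⁺ : ∀ {z} → P z → z ∈ₛ separate P?
  separate⁺ {z} pz = lookup⇒[]= z _ (trans (lookup∘tabulate (does ∘ P?) z) (dec-true (P? z) pz))

  separate⁻ : ∀ {z} → z ∈ₛ separate P? → P z
  separate⁻ {z} z∈ with P? z | trans (sym (lookup∘tabulate (does ∘ P?) z)) ([]=⇒lookup z∈)
  ... | yes pz | _ = pz

-- A vertex serves as its own private colour; a pair consists of a leg number and a position.
Colour : ℕ → Set
Colour n = Fin n ⊎ ℕ × ℕ

_≟ᶜ_ : ∀ {n} → DecidableEquality (Colour n)
_≟ᶜ_ = Sum.≡-dec Fin._≟_ (Product.≡-dec _≟_ _≟_)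

module _ {n : ℕ} where

  -- No shared colour is equal to this pair, since their leg numbers are at least 2.
  rest : Colour n
  rest = inj₂ (0 , 0)

  -- The colour of the vertex z at position p of leg number i of a hub: z has a
  -- colour of its own on the first two legs; on the other legs the colour is
  -- shared with the corresponding vertices at the other hubs.
  paint : ℕ → Fin n → ℕ → Colour n
  paint 0             z p = inj₁ z
  paint 1             z p = inj₁ z
  paint (suc (suc i)) z p = inj₂ (2 + i , p)

  paint-inv : ∀ i {z p} i′ {z′ p′} → paint i z p ≡ paint i′ z′ p′ → z ≡ z′ ⊎ 2 ≤ i × i ≡ i′ × p ≡ p′
  paint-inv 0             0              refl = inj₁ refl
  paint-inv 0             1              refl = inj₁ refl
  paint-inv 1             0              refl = inj₁ refl
  paint-inv 1             1              refl = inj₁ refl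
  paint-inv (suc (suc i)) (suc (suc i′)) refl = inj₂ (s≤s (s≤s z≤n) , refl , refl)

  paint-≢-rest : ∀ i {z p} → paint i z p ≢ rest
  paint-≢-rest 0             ()
  paint-≢-rest 1             ()
  paint-≢-rest (suc (suc i)) ()

module Colouring {n : ℕ} (T : Tree n) (k : ℕ) (1≤k : 1 ≤ k) (k≤ς : k ≤ ς T) where
  open Metric T
  open Legs T
  open Lengths T

  share : Fin n → ℕ
  share w = (k ∸ ℓ w) ⊔ ⌈ k /2⌉

  -- On leg number 0 this is the minimum of `ℓ w` and `⌊ k /2⌋`, written as the complement of
  -- `share w` in `k`.
  size : Fin n → ℕ → ℕ
  size w zero    = k ∸ share w
  size w (suc _) = share w

  1≤share : ∀ w → 1 ≤ share w
  1≤share w = ≤-trans (⌈n/2⌉-mono 1≤k) (m≤n⊔m (k ∸ ℓ w) _)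

  1≤size : ∀ w {i} → 1 ≤ i → 1 ≤ size w i
  1≤size w (s≤s _) = 1≤share w

  share≤k : ∀ w → share w ≤ k
  share≤k w = ⊔-lub (m∸n≤m k (ℓ w)) (⌈n/2⌉≤n k)

  -- Leg number 0 and any other leg are complementary by definition; two other legs have at least
  -- `⌈ k /2⌉` each.
  size-sum : ∀ w {i j} → i ≢ j → k ≤ size w i + size w j
  size-sum w {zero}  {zero}  i≢j = contradiction refl i≢j
  size-sum w {zero}  {suc j} _   = ≤-reflexive (sym (m∸n+n≡m (share≤k w)))
  size-sum w {suc i} {zero}  _   = ≤-reflexive (sym (m+[n∸m]≡n (share≤k w)))
  size-sum w {suc i} {suc j} _   = begin
    k                     ≡⟨ ⌊n/2⌋+⌈n/2⌉≡n k ⟨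
    ⌊ k /2⌋ + ⌈ k /2⌉     ≤⟨ +-mono-≤ (≤-trans (⌊n/2⌋≤⌈n/2⌉ k) half≤) half≤ ⟩
    share w + share w     ∎
    where
    open ≤-Reasoning
    half≤ : ⌈ k /2⌉ ≤ share w
    half≤ = m≤n⊔m (k ∸ ℓ w) _

  Index : Fin n → Set
  Index w = Fin (length (legs w))

  leg : ∀ w → Index w → Fin n
  leg w = lookup (legs w)

  leg-injective : ∀ {w i j} → leg w i ≡ leg w j → i ≡ j
  leg-injective {w} = lookup-injective (legs-unique w)

  -- Leg number 0 has to carry at most `ℓ w` colours. Any other leg together with leg number 0, of
  -- length `ℓ w`, has length at least `ς T`, hence at least `k`; as it is itself no shorter than
  -- `ℓ w`, it also has length at least `⌈ k /2⌉`.
  size-fits : ∀ {w} → Hub w → ∀ i → size w (toℕ i) ≤ dist w (leg w i)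
  size-fits {w} hub i with toℕ i in eq
  ... | zero  = begin
    k ∸ share w     ≤⟨ ∸-monoʳ-≤ k (m≤m⊔n (k ∸ ℓ w) _) ⟩
    k ∸ (k ∸ ℓ w)   ≤⟨ m≤n+o⇒m∸n≤o k (k ∸ ℓ w) (≤-trans (m≤n+m∸n k (ℓ w)) (≤-reflexive (+-comm (ℓ w) _))) ⟩
    ℓ w             ≤⟨ ℓ-≤ (leg-is-terminal i) ⟩
    dist (leg w i) w ≡⟨ d-sym (leg w i) w ⟩
    dist w (leg w i) ∎
    where open ≤-Reasoning
  ... | suc j = begin
    share w          ≤⟨ ⊔-lub (m≤n+o⇒m∸n≤o k (ℓ w) k≤) half≤ ⟩
    dist (leg w i) w ≡⟨ d-sym (leg w i) w ⟩
    dist w (leg w i) ∎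
    where
    open ≤-Reasoning
    0F : Index w
    0F = fromℕ< {0} (≤-trans (s≤s z≤n) (≤-trans (Hub.forked hub) (≤-reflexive (sym (legs-length w)))))
    0F≡0 : toℕ 0F ≡ 0
    0F≡0 = Fin.toℕ-fromℕ< _
    k≤ : k ≤ ℓ w + dist (leg w i) w
    k≤ = begin
      k                                       ≤⟨ k≤ς ⟩
      ς T                                     ≤⟨ ς-≤ (leg-is-terminal 0F) (leg-is-terminal i)
        (λ same → case trans (sym 0F≡0) (trans (cong toℕ (leg-injective same)) eq) of λ ()) ⟩
      dist (leg w 0F) w + dist (leg w i) w    ≤⟨ +-monoˡ-≤ _ (first-leg 0F 0F≡0) ⟩
      ℓ w + dist (leg w i) w                  ∎
    half≤ : ⌈ k /2⌉ ≤ dist (leg w i) w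
    half≤ = begin
      ⌈ k /2⌉                                     ≤⟨ ⌈n/2⌉-mono (≤-trans k≤ (+-monoˡ-≤ _ (ℓ-≤ (leg-is-terminal i)))) ⟩
      ⌈ dist (leg w i) w + dist (leg w i) w /2⌉   ≡⟨ n≡⌈n+n/2⌉ _ ⟨
      dist (leg w i) w                            ∎

  Spot : ∀ w → Index w → Fin n → Set
  Spot w i z = OnLeg w (leg w i) z × dist w z ≤ size w (toℕ i)

  HubSpot : Fin n → Set
  HubSpot z = ∃ λ w → Hub w × ∃ λ i → Spot w i z

  hub-spot? : Decidable HubSpot
  hub-spot? z = Fin.any? λ w → hub? w ×-dec Fin.any? λ i →
    on-leg? w (leg w i) z ×-dec (dist w z ≤? size w (toℕ i))

  opaque
    colour′ : ∀ z → Dec (HubSpot z) → Colour n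
    colour′ z (yes (w , _ , i , _)) = paint (toℕ i) z (dist w z)
    colour′ z (no _)                = rest

    colour : Fin n → Colour n
    colour z = colour′ z (hub-spot? z)

    colour-view : ∀ z → (∃ λ w → Hub w × ∃ λ i → Spot w i z × colour z ≡ paint (toℕ i) z (dist w z)) ⊎ colour z ≡ rest
    colour-view z with hub-spot? z
    ... | yes (w , hub , i , spot) = inj₁ (w , hub , i , spot , refl)
    ... | no  _                    = inj₂ refl

    -- Whatever hub and leg the search finds for `z` are `w` and `i`, because legs are disjoint.
    colour-spot : ∀ {w i z} → Hub w → Spot w i z → colour z ≡ paint (toℕ i) z (dist w z)
    colour-spot {w} {i} {z} hub (on , within) = go (hub-spot? z)
      where
      go : ∀ dec → colour′ z dec ≡ paint (toℕ i) z (dist w z)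
      go (no none) = contradiction (w , hub , i , on , within) none
      go (yes (w′ , _ , i′ , on′ , _))
        with refl ← leg-base-unique (leg-is-terminal i) (leg-is-terminal i′) on on′
        with refl ← leg-injective (leg-end-unique (leg-is-terminal i) (leg-is-terminal i′) on on′) = refl

  spot-unique : ∀ {w i z z′} → Spot w i z → Spot w i z′ → dist w z ≡ dist w z′ → z ≡ z′
  spot-unique ((_ , btw) , _) ((_ , btw′) , _) = between-unique btw btw′

  -- z′ has the shared colour of z, but belongs to a different hub.
  record Twin (w : Fin n) (i : Index w) (z z′ : Fin n) : Set where
    field
      {base}    : Fin n
      base-hub  : Hub base
      base≢     : base ≢ w
      {number}  : Index base
      spot      : Spot base number z′
      number≡   : toℕ number ≡ toℕ i
      position≡ : dist base z′ ≡ dist w z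
      shared    : 2 ≤ toℕ i

  -- A colour that repeats is shared and fixes leg number and position; at the hub `w` itself these
  -- determine the vertex.
  colour-class : ∀ {w i z z′} → Hub w → Spot w i z → colour z′ ≡ colour z → z′ ≡ z ⊎ Twin w i z z′
  colour-class {w} {i} {z} {z′} hub spot same with colour-view z′
  ... | inj₂ eq = contradiction (trans (sym (colour-spot hub spot)) (trans (sym same) eq)) (paint-≢-rest (toℕ i))
  ... | inj₁ (w′ , hub′ , i′ , spot′ , eq) =
    by-paint (paint-inv (toℕ i′) (toℕ i) (trans (sym eq) (trans same (colour-spot hub spot))))
    where
    by-base : ∀ {w′} {i′ : Index w′} → Hub w′ → Spot w′ i′ z′ → 2 ≤ toℕ i′ → toℕ i′ ≡ toℕ i →
      dist w′ z′ ≡ dist w z → Dec (w′ ≡ w) → z′ ≡ z ⊎ Twin w i z z′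
    by-base _ spot′ _ i′≡i p′≡p (yes refl) with refl ← Fin.toℕ-injective i′≡i = inj₁ (spot-unique spot′ spot p′≡p)
    by-base hub′ spot′ 2≤i′ i′≡i p′≡p (no w′≢w) = inj₂ record
      { base-hub = hub′ ; base≢ = w′≢w ; spot = spot′ ; number≡ = i′≡i ; position≡ = p′≡p
      ; shared = subst (2 ≤_) i′≡i 2≤i′ }
    by-paint : z′ ≡ z ⊎ 2 ≤ toℕ i′ × toℕ i′ ≡ toℕ i × dist w′ z′ ≡ dist w z → z′ ≡ z ⊎ Twin w i z z′
    by-paint (inj₁ z′≡z) = inj₁ z′≡z
    by-paint (inj₂ (2≤i′ , i′≡i , p′≡p)) = by-base hub′ spot′ 2≤i′ i′≡i p′≡p (w′ Fin.≟ w)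

  colour-injective : ∀ {w i i′ z z′} → Hub w → Spot w i z → Spot w i′ z′ → colour z′ ≡ colour z → z′ ≡ z
  colour-injective {i′ = i′} hub spot (on′ , _) same with colour-class hub spot same
  ... | inj₁ z′≡z = z′≡z
  ... | inj₂ twin = contradiction
    (leg-base-unique (leg-is-terminal number) (leg-is-terminal i′) (proj₁ spot′) on′) base≢
    where open Twin twin renaming (spot to spot′)

  class : Colour n → Subset n
  class γ = separate λ z → colour z ≟ᶜ γ

  Separated : Fin n → Fin n → Fin n → Set
  Separated x y z = Distinguishes T x y (class (colour z))

  separated-sym : ∀ {x y z} → Separated x y z → Separated y x z
  separated-sym = ≢-sym

  separated : ∀ {x y z} → (∀ z′ → colour z′ ≡ colour z → ∃ λ z″ → colour z″ ≡ colour z × dist x z″ < dist y z′) →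
    Separated x y z
  separated {x} {y} {z} closer = distinguish (separate⁺ P? refl) λ z′∈ →
    let z″ , same , lt = closer _ (separate⁻ P? z′∈) in z″ , separate⁺ P? same , lt
    where
    P? : Decidable λ z′ → colour z′ ≡ colour z
    P? z′ = colour z′ ≟ᶜ colour z

  single-colour : ∀ {w i z z′} → Hub w → Spot w i z → toℕ i < 2 → colour z′ ≡ colour z → z′ ≡ z
  single-colour hub spot i<2 same with colour-class hub spot same
  ... | inj₁ z′≡z = z′≡z
  ... | inj₂ twin = contradiction (Twin.shared twin) (<⇒≱ i<2)

  -- The class of a private colour consists of `z` alone.
  separated-single : ∀ {x y w i z} → Hub w → Spot w i z → toℕ i < 2 → dist x z ≢ dist y z → Separated x y z
  separated-single {x} {y} {z = z} hub spot i<2 ≢ = by-order (<-cmp (dist x z) (dist y z))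
    where
    closer : ∀ {x y} → dist x z < dist y z → Separated x y z
    closer {x} {y} lt = separated λ z′ same →
      z , refl , subst (λ v → dist x z < dist y v) (sym (single-colour hub spot i<2 same)) lt
    by-order : Tri (dist x z < dist y z) (dist x z ≡ dist y z) (dist x z > dist y z) → Separated x y z
    by-order (tri< lt _ _) = closer lt
    by-order (tri≈ _ eq _) = contradiction eq ≢
    by-order (tri> _ _ gt) = separated-sym {y} {x} (closer gt)

-- Any two vertices are distinguished by at least k classes

unique-map : ∀ {a b} {A : Set a} {B : Set b} {f : A → B} {xs} → Unique xs →
  (∀ {x y} → x ∈ xs → y ∈ xs → f x ≡ f y → x ≡ y) → Unique (map f xs)
unique-map []         _     = []
unique-map (x∉ ∷ xs!) f-inj =
  All.map⁺ (All.tabulate λ y∈ eq → All.lookup x∉ y∈ (f-inj (here refl) (there y∈) eq)) ∷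
  unique-map xs! λ x∈ y∈ → f-inj (there x∈) (there y∈)

module Separation {n : ℕ} (T : Tree n) (k : ℕ) (1≤k : 1 ≤ k) (k≤ς : k ≤ ς T) where
  open Tree T
  open Metric T
  open Branches T
  open Legs T
  open Paths T
  open Lengths T
  open Colouring T k 1≤k k≤ς

  module _ {w : Fin n} (hub : Hub w) where

    opaque
      -- `Fin` counts from 0, but positions on a leg count from 1, the hub being at position 0.
      point : ∀ i (p : Fin (size w (toℕ i))) → ∃ λ z → dist w z ≡ suc (toℕ p) × Between w z (leg w i)
      point i p = between-point w (leg w i) (suc (toℕ p)) (≤-trans (Fin.toℕ<n p) (size-fits hub i))

    point-spot : ∀ i p → Spot w i (proj₁ (point i p))
    point-spot i p = (z≢w , btw) , ≤-trans (≤-reflexive at) (Fin.toℕ<n p)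
      where
      at : dist w (proj₁ (point i p)) ≡ suc (toℕ p)
      at = proj₁ (proj₂ (point i p))
      btw : Between w (proj₁ (point i p)) (leg w i)
      btw = proj₂ (proj₂ (point i p))
      z≢w : proj₁ (point i p) ≢ w
      z≢w eq = case trans (sym at) (trans (cong (dist w) eq) (d-refl w)) of λ ()

    spots : Index w → List (Fin n)
    spots i = tabulate (λ p → proj₁ (point i p))

    spots⁻ : ∀ i {z} → z ∈ spots i → Spot w i z
    spots⁻ i z∈ with ∈-tabulate⁻ z∈
    ... | p , refl = point-spot i p

    spots⁺ : ∀ i {z} → Spot w i z → z ∈ spots i
    spots⁺ i {z} spot@((z≢w , _) , within) = go (dist w z) refl
      where
      go : ∀ d → dist w z ≡ d → z ∈ spots i
      go zero    at = contradiction (sym (d≡0⇒≡ at)) z≢w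
      go (suc d) at = subst (_∈ spots i) (sym (spot-unique spot (point-spot i p)
          (trans at (sym (trans (proj₁ (proj₂ (point i p))) (cong suc (Fin.toℕ-fromℕ< d<)))))))
          (∈-tabulate⁺ p)
        where
        d< : d < size w (toℕ i)
        d< = subst (_≤ size w (toℕ i)) at within
        p : Fin (size w (toℕ i))
        p = fromℕ< d<

    spots-length : ∀ i → length (spots i) ≡ size w (toℕ i)
    spots-length i = length-tabulate (λ p → proj₁ (point i p))

    spots-unique : ∀ i → Unique (spots i)
    spots-unique i = Unique.tabulate⁺ λ {p} {q} eq → Fin.toℕ-injective (suc-injective
      (trans (sym (proj₁ (proj₂ (point i p)))) (trans (cong (dist w) eq) (proj₁ (proj₂ (point i q))))))

    leg-pair : Index w → Index w → List (Fin n)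
    leg-pair i j = spots i ++ spots j

    leg-pair⁻ : ∀ i j {z} → z ∈ leg-pair i j → Spot w i z ⊎ Spot w j z
    leg-pair⁻ i j z∈ with ∈-++⁻ (spots i) z∈
    ... | inj₁ z∈i = inj₁ (spots⁻ i z∈i)
    ... | inj₂ z∈j = inj₂ (spots⁻ j z∈j)

    leg-pair-unique : ∀ {i j} → i ≢ j → Unique (leg-pair i j)
    leg-pair-unique {i} {j} i≢j = Unique.++⁺ (spots-unique i) (spots-unique j) λ (z∈i , z∈j) →
      i≢j (leg-injective (leg-end-unique (leg-is-terminal i) (leg-is-terminal j)
        (proj₁ (spots⁻ i z∈i)) (proj₁ (spots⁻ j z∈j))))

    leg-pair-length : ∀ i j → length (leg-pair i j) ≡ size w (toℕ i) + size w (toℕ j)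
    leg-pair-length i j = trans (length-++ (spots i)) (cong₂ _+_ (spots-length i) (spots-length j))

    index< : ∀ p → p < 2 → Index w
    index< p p<2 = fromℕ< (≤-trans p<2 (≤-trans (Hub.forked hub) (≤-reflexive (sym (legs-length w)))))

    opaque
      0F 1F : Index w
      0F = index< 0 (s≤s z≤n)
      1F = index< 1 (s≤s (s≤s z≤n))

      0F≡0 : toℕ 0F ≡ 0
      0F≡0 = Fin.toℕ-fromℕ< _

      1F≡1 : toℕ 1F ≡ 1
      1F≡1 = Fin.toℕ-fromℕ< _

    0F≢1F : 0F ≢ 1F
    0F≢1F eq = case trans (sym 0F≡0) (trans (cong toℕ eq) 1F≡1) of λ ()

    first-two : ∀ {i} → toℕ i < 2 → i ≡ 0F ⊎ i ≡ 1F
    first-two {i} i<2 with toℕ i in eq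
    ... | 0 = inj₁ (Fin.toℕ-injective (trans eq (sym 0F≡0)))
    ... | 1 = inj₂ (Fin.toℕ-injective (trans eq (sym 1F≡1)))
    first-two {i} (s≤s (s≤s ())) | suc (suc _)

    singles : List (Fin n)
    singles = leg-pair 0F 1F

    singles⁻ : ∀ {z} → z ∈ singles → ∃ λ i → toℕ i < 2 × Spot w i z
    singles⁻ z∈ with leg-pair⁻ 0F 1F z∈
    ... | inj₁ spot = 0F , subst (_< 2) (sym 0F≡0) (s≤s z≤n) , spot
    ... | inj₂ spot = 1F , subst (_< 2) (sym 1F≡1) (s≤s (s≤s z≤n)) , spot

    singles⁺ : ∀ {i z} → toℕ i < 2 → Spot w i z → z ∈ singles
    singles⁺ {i} i<2 spot with first-two i<2
    ... | inj₁ refl = ∈-++⁺ˡ (spots⁺ i spot)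
    ... | inj₂ refl = ∈-++⁺ʳ (spots 0F) (spots⁺ i spot)

  -- Representatives of at least `k` different classes that distinguish `x` and `y`.
  record Witnesses (x y : Fin n) : Set where
    field
      {vertices} : List (Fin n)
      distinct   : Unique (map colour vertices)
      separating : ∀ {z} → z ∈ vertices → Separated x y z
      enough     : k ≤ length vertices

  witnesses-sym : ∀ {x y} → Witnesses x y → Witnesses y x
  witnesses-sym {x} {y} ws = record
    { distinct = distinct ; separating = λ z∈ → separated-sym {x} {y} (separating z∈) ; enough = enough }
    where open Witnesses ws

  hub-colours : ∀ {w zs} → Hub w → Unique zs → (∀ {z} → z ∈ zs → ∃ λ i → Spot w i z) → Unique (map colour zs)
  hub-colours hub zs! spotted = unique-map zs! λ x∈ y∈ →
    colour-injective hub (proj₂ (spotted y∈)) (proj₂ (spotted x∈))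

  pair-witnesses : ∀ {x y w} (hub : Hub w) {i j : Index w} → i ≢ j →
    (∀ {z} → Spot w i z ⊎ Spot w j z → Separated x y z) → Witnesses x y
  pair-witnesses {w = w} hub {i} {j} i≢j sep = record
    { vertices   = leg-pair hub i j
    ; distinct   = hub-colours hub (leg-pair-unique hub i≢j) λ z∈ →
        [ (i ,_) , (j ,_) ]′ (leg-pair⁻ hub i j z∈)
    ; separating = sep ∘ leg-pair⁻ hub i j
    ; enough     = ≤-trans (size-sum w (i≢j ∘ Fin.toℕ-injective)) (≤-reflexive (sym (leg-pair-length hub i j))) }

  single-witnesses : ∀ {x y w} → Hub w →
    (∀ {i z} → toℕ i < 2 → Spot w i z → dist x z ≢ dist y z) → Witnesses x y
  single-witnesses {x} {y} {w} hub ≢ = pair-witnesses hub (0F≢1F hub) λ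
    { (inj₁ spot) → sep (0F≡0 hub) (s≤s z≤n) spot
    ; (inj₂ spot) → sep (1F≡1 hub) (s≤s (s≤s z≤n)) spot }
    where
    sep : ∀ {i p z} → toℕ i ≡ p → p < 2 → Spot w i z → Separated x y z
    sep {i} refl i<2 spot = separated-single hub spot i<2 (≢ {i} i<2 spot)

  module _ {x y : Fin n} (f : Fork x y) where
    open Fork f

    -- A third neighbour of `m`, besides `a` and `b`, would make it major.
    two-sided : ∀ {z} → ¬ Major T m → z ≢ m → ¬ Branch m b z → Branch m a z
    two-sided ¬major z≢m z∉b with toward (z≢m ∘ sym)
    ... | c , z∈c with c Fin.≟ a | c Fin.≟ b
    ...   | yes refl | _        = z∈c
    ...   | no _     | yes refl = contradiction z∈c z∉b
    ...   | no c≢a   | no c≢b   = contradiction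
      (three-neighbours (proj₁ z∈c) (proj₁ x∈a) (proj₁ y∈b) c≢a c≢b a≢b) ¬major

    -- If `z` is in one of the two branches, `side-closer` applies. Otherwise `m` is on the path
    -- from `w` to `z`, hence on the leg and not major, and then `two-sided` leaves no place for
    -- `z`.
    leg-separates : ∀ {w u z} → Branch m a w → Terminal w u → OnLeg w u z → z ≢ m → dist x z ≢ dist y z
    leg-separates {w} {u} {z} w∈a t (z≢w , btw) z≢m with branch? m a z | branch? m b z
    ... | yes z∈a | _       = <⇒≢ (side-closer f z∈a)
    ... | no _    | yes z∈b = ≢-sym (<⇒≢ (side-closer (fork-sym f) z∈b))
    ... | no z∉a  | no z∉b  = contradiction (two-sided (leg-not-major t (branch-≢ w∈a ∘ sym , m-btw)) z≢m z∉b) z∉a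
      where
      m-btw : Between w m u
      m-btw = ≤-antisym (begin
        dist w m + dist m u                ≤⟨ +-monoʳ-≤ (dist w m) (d-triangle m z u) ⟩
        dist w m + (dist m z + dist z u)   ≡⟨ +-assoc (dist w m) (dist m z) (dist z u) ⟨
        dist w m + dist m z + dist z u     ≡⟨ cong (_+ dist z u) (trans (+-comm (dist w m) (dist m z))
                                                (trans (cong₂ _+_ (d-sym m z) (d-sym w m))
                                                  (trans (sym (crossing w∈a z∉a)) (d-sym z w)))) ⟩
        dist w z + dist z u                ≡⟨ btw ⟩
        dist w u                           ∎) (d-triangle w m u)
        where open ≤-Reasoning

    -- Here `m` has a private colour of `w`. Its class does not distinguish `x` and `y`, both being
    -- at the same distance from `m`, so the private colours of `w` are one short of `k`.
    module _ {w : Fin n} (hub : Hub w) (w∈a : Branch m a w) {i : Index w} (i<2 : toℕ i < 2) (spot : Spot w i m) where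

      ¬major : ¬ Major T m
      ¬major = leg-not-major (leg-is-terminal i) (proj₁ spot)

      -- Beyond m only the leg number i < 2 of w itself continues.
      third-leg-side : ∀ {w′ j z} → 2 ≤ toℕ j → Spot w′ j z → Branch m a z
      third-leg-side {w′} {j} {z} 2≤j (on , _) = two-sided ¬major
        (λ { refl → other-leg (proj₁ spot) })
        λ z∈b → let c , i∈c = toward (terminal-≢ (leg-is-terminal i)) in
          other-leg (branch⇒on-leg (leg-is-terminal i) i∈c
            (branch-trans (on-leg⇒branch i∈c (proj₁ spot)) (branches-disjoint f w∈a) z∈b))
        where
        other-leg : ¬ OnLeg w (leg w i) z
        other-leg on′ with refl ← leg-base-unique (leg-is-terminal j) (leg-is-terminal i) on on′
          with refl ← leg-injective (leg-end-unique (leg-is-terminal j) (leg-is-terminal i) on on′) =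
          <⇒≱ i<2 2≤j

      -- The first vertex `q` of leg `j` replaces `m`. By `third-leg-side` its whole class lies
      -- behind `a`, where every vertex is nearer to `x` than to `y`.
      third-leg-witnesses : ∀ j → 2 ≤ toℕ j → Witnesses x y
      third-leg-witnesses j 2≤j = record
        { vertices   = q ∷ others
        ; distinct   = hub-colours hub
            (All.tabulate (λ z∈ q≡z → q∉ (subst (_∈ others) (sym q≡z) z∈))
              ∷ Unique.filter⁺ ≢m? (leg-pair-unique hub (0F≢1F hub)))
            λ { (here refl) → j , q-spot ; (there z∈) → let i , _ , s = old z∈ in i , s }
        ; separating = λ { (here refl) → q-separated
                         ; (there z∈) → let i , i<2 , s = old z∈ in separated-single hub s i<2
                             (leg-separates w∈a (leg-is-terminal i) (proj₁ s)
                               (proj₂ (∈-filter⁻ ≢m? {xs = singles hub} z∈))) }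
        ; enough     = ≤-trans (size-sum w (0F≢1F hub ∘ Fin.toℕ-injective))
            (≤-trans (≤-reflexive (sym (leg-pair-length hub (0F hub) (1F hub))))
              (unique-⊆-length (leg-pair-unique hub (0F≢1F hub)) covered)) }
        where
        ≢m? : ∀ z → Dec (z ≢ m)
        ≢m? z = ¬? (z Fin.≟ m)
        others : List (Fin n)
        others = filter ≢m? (singles hub)
        old : ∀ {z} → z ∈ others → ∃ λ i → toℕ i < 2 × Spot w i z
        old z∈ = singles⁻ hub (proj₁ (∈-filter⁻ ≢m? z∈))
        first : 0 < size w (toℕ j)
        first = 1≤size w (<⇒≤ 2≤j)
        q : Fin n
        q = proj₁ (point hub j (fromℕ< first))
        q-spot : Spot w j q
        q-spot = point-spot hub j (fromℕ< first)
        q∉ : ¬ q ∈ others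
        q∉ q∈ with old q∈
        ... | i , i<2 , s
          with refl ← leg-injective (leg-end-unique (leg-is-terminal i) (leg-is-terminal j) (proj₁ s) (proj₁ q-spot)) =
          <⇒≱ i<2 2≤j
        covered : ∀ {z} → z ∈ singles hub → z ∈ m ∷ others
        covered {z} z∈ with z Fin.≟ m
        ... | yes refl = here refl
        ... | no  z≢m  = there (∈-filter⁺ ≢m? z∈ z≢m)
        q-separated : Separated x y q
        q-separated = separated λ z′ same → z′ , same , side-closer f (side (colour-class hub q-spot same))
          where
          side : ∀ {z′} → z′ ≡ q ⊎ Twin w j q z′ → Branch m a z′
          side (inj₁ refl) = third-leg-side 2≤j q-spot
          side (inj₂ twin) = third-leg-side (subst (2 ≤_) (sym number≡) 2≤j) spot′
            where open Twin twin renaming (spot to spot′)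

      third-branch-witnesses : ∀ {c} → w ~ c → (∀ {i} → toℕ i < 2 → ¬ Branch w c (leg w i)) → Witnesses x y
      third-branch-witnesses {c} w~c avoids = by-content (hub-or-terminal (Hub.major hub) w~c)
        where
        m∉c : ¬ Branch w c m
        m∉c m∈c = avoids i<2 (branch-leg (leg-is-terminal i) (proj₁ spot) m∈c)
        by-content : (∃ λ w′ → Branch w c w′ × Hub w′) ⊎ (∃ λ u → Branch w c u × Terminal w u) → Witnesses x y
        -- The hub `w′` is behind `a` too, and `m`, which is on a leg of `w`, is on no leg of `w′`;
        -- so none of the private colours of `w′` is lost.
        by-content (inj₁ (w′ , w′∈c , hub′)) = single-witnesses hub′ λ {j} _ (on , _) →
          leg-separates (branch-trans w∈a m∉c w′∈c) (leg-is-terminal j) on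
            λ { refl → branch-≢ w′∈c (leg-base-unique (leg-is-terminal j) (leg-is-terminal i) on (proj₁ spot)) }
        by-content (inj₂ (u , u∈c , t)) = by-index (leg-index t)
          where
          by-index : (∃ λ j → leg w j ≡ u) → Witnesses x y
          by-index (j , refl) = third-leg-witnesses j (≮⇒≥ λ j<2 → avoids j<2 u∈c)

      blocked-witnesses : Witnesses x y
      blocked-witnesses =
        let c₀ , ∈c₀ = toward (terminal-≢ (leg-is-terminal (0F hub)))
            c₁ , ∈c₁ = toward (terminal-≢ (leg-is-terminal (1F hub)))
            c , w~c , c≢c₀ , c≢c₁ = third-neighbour (Hub.major hub) c₀ c₁
        in third-branch-witnesses w~c λ j<2 ∈c → case first-two hub j<2 of λ
          { (inj₁ refl) → c≢c₀ (branch-unique ∈c ∈c₀)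
          ; (inj₂ refl) → c≢c₁ (branch-unique ∈c ∈c₁) }

    side-hub-witnesses : ∀ {w} → Hub w → Branch m a w → Witnesses x y
    side-hub-witnesses {w} hub w∈a
      with Fin.any? (λ i → (toℕ i <? 2) ×-dec on-leg? w (leg w i) m ×-dec (dist w m ≤? size w (toℕ i)))
    ... | yes (i , i<2 , spot) = blocked-witnesses hub w∈a i<2 spot
    ... | no  free             = single-witnesses hub λ {i} i<2 spot →
      leg-separates w∈a (leg-is-terminal i) (proj₁ spot) λ { refl → free (i , i<2 , spot) }

    -- A twin of `z` behind `b` would be on leg `j` of `m`, so from `y` every twin is reached
    -- through `m`. A twin is nearer to its own hub than to `m`, and its distance from that hub is
    -- the distance from `m` to `z`.
    centre-leg : ∀ {i j : Index m} → Hub m → Branch m a (leg m i) → Branch m b (leg m j) →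
      ∀ {z} → Spot m i z → Separated x y z
    centre-leg {i} {j} hub i∈a j∈b {z} spot = separated λ z′ same → z , refl , closer (colour-class hub spot same)
      where
      open ≤-Reasoning
      z∈a : Branch m a z
      z∈a = on-leg⇒branch i∈a (proj₁ spot)
      closer : ∀ {z′} → z′ ≡ z ⊎ Twin m i z z′ → dist x z < dist y z′
      closer (inj₁ refl) = side-closer f z∈a
      closer {z′} (inj₂ twin) = begin-strict
        dist x z             <⟨ ≤-trans (n≤1+n _) (near-side f z∈a) ⟩
        dist m x + dist m z  ≤⟨ +-monoʳ-≤ (dist m x) (<⇒≤ mz<mz′) ⟩
        dist m x + dist m z′ ≡⟨ far-side f z′∉b ⟨
        dist y z′            ∎
        where
        open Twin twin renaming (spot to spot′)
        z′∉b : ¬ Branch m b z′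
        z′∉b z′∈b = base≢ (leg-base-unique (leg-is-terminal number) (leg-is-terminal j)
          (proj₁ spot′) (branch⇒on-leg (leg-is-terminal j) j∈b z′∈b))
        mz<mz′ : dist m z < dist m z′
        mz<mz′ = begin-strict
          dist m z      ≡⟨ position≡ ⟨
          dist base z′  ≡⟨ d-sym base z′ ⟩
          dist z′ base  <⟨ leg-nearest (leg-is-terminal number) (proj₁ spot′) (Hub.major hub) (base≢ ∘ sym) ⟩
          dist z′ m     ≡⟨ d-sym z′ m ⟩
          dist m z′     ∎

  module _ (¬path : ¬ IsPath graph) where

    opaque
      -- To apply `hub-in-branch`, the major vertex `v` is viewed as the tip of a branch at its
      -- neighbour `c`.
      some-hub : ∃ Hub
      some-hub =
        let v , major = some-major ¬path
            c , v~c , _ = third-neighbour major v v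
            w , _ , hub = hub-in-branch (branch-tip (~-sym v~c)) major
        in w , hub

    module _ {x y : Fin n} (f : Fork x y) where
      open Fork f

      centre-witnesses : (∀ z → Branch m a z → ¬ Major T z) → (∀ z → Branch m b z → ¬ Major T z) → Witnesses x y
      centre-witnesses bare-a bare-b = from-major (major? T m)
        where
        from-major : Dec (Major T m) → Witnesses x y
        -- Every vertex is then `m` or lies in one of the two bare branches, so the tree would have
        -- no major vertex.
        from-major (no ¬major) with some-major ¬path
        ... | v , v-major = contradiction v-major (bare-a v
          (two-sided f ¬major (λ { refl → ¬major v-major }) λ v∈b → bare-b v v∈b v-major))
        from-major (yes major) with leg-terminal major (proj₁ x∈a) bare-a | leg-terminal major (proj₁ y∈b) bare-b
        ... | u , u∈a , t | v , v∈b , s with leg-index t | leg-index s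
        ...   | i , refl | j , refl = pair-witnesses hub i≢j λ
          { (inj₁ spot) → centre-leg f hub u∈a v∈b spot
          ; (inj₂ spot) → separated-sym {y} {x} (centre-leg (fork-sym f) hub v∈b u∈a spot) }
          where
          i≢j : i ≢ j
          i≢j refl = branches-disjoint f u∈a v∈b
          hub : Hub m
          hub = hub-of-terminals t s (i≢j ∘ leg-injective)

    fork-witnesses : ∀ {x y} → Fork x y → Witnesses x y
    fork-witnesses f with Fin.any? (λ w → branch? (Fork.m f) (Fork.a f) w ×-dec hub? w)
                        | Fin.any? (λ w → branch? (Fork.m f) (Fork.b f) w ×-dec hub? w)
    ... | yes (w , w∈a , hub) | _                   = side-hub-witnesses f hub w∈a
    ... | no _                | yes (w , w∈b , hub) = witnesses-sym (side-hub-witnesses (fork-sym f) hub w∈b)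
    ... | no a-free           | no b-free           = centre-witnesses f
      (λ z z∈ major → a-free (hub-in-branch z∈ major)) (λ z z∈ major → b-free (hub-in-branch z∈ major))

    witnesses : ∀ {x y} → x ≢ y → Witnesses x y
    witnesses {x} {y} x≢y = by-fork (Fin.any? (λ v → dist x v ≟ dist y v))
      where
      by-fork : Dec (∃ λ v → dist x v ≡ dist y v) → Witnesses x y
      by-fork (yes (v , eq)) = fork-witnesses (fork x≢y eq)
      -- No vertex is equidistant from `x` and `y`, so the private colours of any hub suffice.
      by-fork (no none)      = single-witnesses (proj₂ some-hub) λ {_} {z} _ _ eq → none (z , eq)

-- Counting the shared colours

length-concatMap : ∀ {a b} {A : Set a} {B : Set b} (f : A → List B) xs →
  length (concatMap f xs) ≡ sum (map (length ∘ f) xs)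
length-concatMap f []       = refl
length-concatMap f (x ∷ xs) = trans (length-++ (f x)) (cong (length (f x) +_) (length-concatMap f xs))

length-cartesianProduct : ∀ {a b} {A : Set a} {B : Set b} (xs : List A) (ys : List B) →
  length (cartesianProduct xs ys) ≡ length xs * length ys
length-cartesianProduct []       ys = refl
length-cartesianProduct (x ∷ xs) ys =
  trans (length-++ (map (x ,_) ys)) (cong₂ _+_ (length-map (x ,_) ys) (length-cartesianProduct xs ys))

maximum-≥ : ∀ {x xs} → x ∈ xs → x ≤ maximum xs
maximum-≥ {xs = xs} x∈ = v≤max⁺ 0 xs (inj₂ (Any.map ≤-reflexive x∈))

-- The interval excludes `b`; `[ a ⋯ b ]` unfolds to the one that ends before `suc b`.
∈-interval⁺ : ∀ {a b i} → a ≤ i → i < b → i ∈ applyUpTo (a +_) (b ∸ a)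
∈-interval⁺ {a} {b} {i} a≤i i<b =
  subst (_∈ applyUpTo (a +_) (b ∸ a)) (m+[n∸m]≡n a≤i) (∈-applyUpTo⁺ (a +_) (∸-monoˡ-< i<b a≤i))

∈-interval⁻ : ∀ {a b i} → i ∈ applyUpTo (a +_) (b ∸ a) → a ≤ i × i < b
∈-interval⁻ {a} {b} i∈ with ∈-applyUpTo⁻ (a +_) i∈
... | j , j< , refl = m≤m+n a j , (begin-strict
    a + j       <⟨ +-monoʳ-< a j< ⟩
    a + (b ∸ a) ≡⟨ m+[n∸m]≡n {a} {b} (<⇒≤ (m∸n≢0⇒n<m λ eq → case subst (j <_) eq j< of λ ())) ⟩
    b           ∎)
  where open ≤-Reasoning

-- Leg numbers from `a` to below `b`, positions from 1 to `h`: the number of pairs has the shape of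
-- a summand of `𝓘`.
block : ℕ → ℕ → ℕ → List (ℕ × ℕ)
block a b h = cartesianProduct (applyUpTo (a +_) (b ∸ a)) (applyUpTo suc h)

length-block : ∀ a b h → length (block a b h) ≡ (b ∸ a) * h
length-block a b h = trans (length-cartesianProduct (applyUpTo (a +_) (b ∸ a)) (applyUpTo suc h))
  (cong₂ _*_ (length-applyUpTo (a +_) (b ∸ a)) (length-applyUpTo suc h))

∈-block : ∀ {a b h i p} → a ≤ i → i < b → 1 ≤ p → p ≤ h → (i , p) ∈ block a b h
∈-block a≤i i<b (s≤s _) p≤h = ∈-cartesianProduct⁺ (∈-interval⁺ a≤i i<b) (∈-applyUpTo⁺ suc p≤h)

entry-∈ : ∀ {x xs} → x ∈ xs → ∃ λ i → 1 ≤ i × i ≤ length xs × entry xs i ≡ x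
entry-∈ (here refl) = 1 , ≤-refl , s≤s z≤n , refl
entry-∈ (there x∈) with entry-∈ x∈
... | suc i , _ , i≤ , eq = suc (suc i) , s≤s z≤n , s≤s i≤ , eq

entry-in : ∀ xs {i} → 1 ≤ i → i ≤ length xs → entry xs i ∈ xs
entry-in (x ∷ xs) {1}           _ _        = here refl
entry-in (x ∷ xs) {suc (suc i)} _ (s≤s i≤) = there (entry-in xs (s≤s z≤n) i≤)

entry-mono : ∀ {xs} → AllPairs _≤_ xs → ∀ {i j} → 1 ≤ i → i ≤ j → j ≤ length xs → entry xs i ≤ entry xs j
entry-mono (_  ∷ _)  {1}           {1}           _ _ _ = ≤-refl
entry-mono {x ∷ xs} (x≤ ∷ _)  {1} {suc (suc j)} _ _ (s≤s j≤) = All.lookup x≤ (entry-in xs (s≤s z≤n) j≤)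
entry-mono (_  ∷ ≤s) {suc (suc i)} {suc (suc j)} _ (s≤s i≤j) (s≤s j≤) = entry-mono ≤s (s≤s z≤n) i≤j j≤
entry-mono (_  ∷ _)  {suc (suc i)} {1}           _ (s≤s ()) _

deduplicate-sorted : ∀ {xs} → AllPairs _≤_ xs → AllPairs _≤_ (deduplicate _≟_ xs)
deduplicate-sorted []        = []
deduplicate-sorted {x ∷ xs} (x≤ ∷ ≤s) =
  All.filter⁺ (¬? ∘ (x ≟_)) (All.deduplicate⁺ _≟_ x≤) ∷ AllPairs.filter⁺ (¬? ∘ (x ≟_)) (deduplicate-sorted ≤s)

module LevelGrid (k r : ℕ) (l t : ℕ → ℕ) (l-mono : ∀ {i j} → 1 ≤ i → i ≤ j → j ≤ r → l i ≤ l j) where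

  t-maximum : ℕ → ℕ → ℕ
  t-maximum a b = maximum (map t [ a ⋯ b ])

  low : List ℕ
  low = filter (λ i → l i ≤? ⌊ k /2⌋) [ 1 ⋯ r ]

  σ : ℕ
  σ = max 1 low

  t-≤-maximum : ∀ {a b j} → a ≤ j → j ≤ b → t j ≤ t-maximum a b
  t-≤-maximum a≤j j≤b = maximum-≥ (∈-map⁺ t (∈-interval⁺ a≤j (s≤s j≤b)))

  t-maximum-≤ : ∀ {a b c} → (∀ {j} → a ≤ j → j ≤ b → t j ≤ c) → t-maximum a b ≤ c
  t-maximum-≤ {a} {b} t≤ = max≤v⁺ z≤n (All.map⁺ (All.tabulate λ j∈ →
    let a≤j , j<1+b = ∈-interval⁻ j∈ in t≤ a≤j (s≤s⁻¹ j<1+b)))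

  high-level : ∀ {j} → 1 ≤ j → j ≤ r → σ < j → ⌊ k /2⌋ < l j
  high-level {j} 1≤j j≤r σ<j = ≰⇒> λ lj≤ → <⇒≱ σ<j (v≤max⁺ 1 low (inj₂
    (Any.map ≤-reflexive (∈-filter⁺ (λ i → l i ≤? ⌊ k /2⌋) (∈-interval⁺ 1≤j (s≤s j≤r)) lj≤))))

  -- Unless `σ` is the default 1, it is a low level itself, and `l` is monotone.
  low-level : ∀ {j} → 2 ≤ j → j ≤ σ → l j ≤ ⌊ k /2⌋
  low-level {j} 2≤j j≤σ with argmax-sel (λ i → i) 1 low
  ... | inj₁ σ≡1 = contradiction (≤-trans 2≤j (≤-trans j≤σ (≤-reflexive σ≡1))) 1+n≰n
  ... | inj₂ σ∈ with ∈-filter⁻ (λ i → l i ≤? ⌊ k /2⌋) {xs = [ 1 ⋯ r ]} σ∈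
  ...   | σ∈r , lσ≤ = ≤-trans (l-mono (<⇒≤ 2≤j) j≤σ (s≤s⁻¹ (proj₂ (∈-interval⁻ σ∈r)))) lσ≤

  middle : ℕ → List (ℕ × ℕ)
  middle i = block (t-maximum 1 (i ∸ 1)) (t i) (k ∸ l i)

  -- One block for each summand of `𝓘`: the first level, the levels from 2 to `σ`, and all levels
  -- above `σ` together.
  grid : List (ℕ × ℕ)
  grid = block 2 (t 1) ((k ∸ l 1) ⊔ ⌈ k /2⌉) ++ concatMap middle [ 2 ⋯ σ ]
      ++ block (t-maximum 1 σ) (t-maximum (suc σ) r) ⌈ k /2⌉

  grid-size : ℕ
  grid-size = (t 1 ∸ 2) * ((k ∸ l 1) ⊔ ⌈ k /2⌉)
      + sum (map (λ i → (t i ∸ t-maximum 1 (i ∸ 1)) * (k ∸ l i)) [ 2 ⋯ σ ])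
      + (t-maximum (suc σ) r ∸ t-maximum 1 σ) * ⌈ k /2⌉

  length-grid : length grid ≡ grid-size
  length-grid = begin
    length (A ++ B ++ C)              ≡⟨ length-++ A ⟩
    length A + length (B ++ C)        ≡⟨ cong (length A +_) (length-++ B) ⟩
    length A + (length B + length C)  ≡⟨ +-assoc (length A) (length B) (length C) ⟨
    length A + length B + length C    ≡⟨ cong₂ _+_ (cong₂ _+_ (length-block 2 (t 1) _) middle-length)
                                           (length-block (t-maximum 1 σ) (t-maximum (suc σ) r) ⌈ k /2⌉) ⟩
    grid-size                         ∎
    where
    open ≡-Reasoning
    A = block 2 (t 1) ((k ∸ l 1) ⊔ ⌈ k /2⌉)
    B = concatMap middle [ 2 ⋯ σ ]
    C = block (t-maximum 1 σ) (t-maximum (suc σ) r) ⌈ k /2⌉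
    middle-length : length B ≡ sum (map (λ i → (t i ∸ t-maximum 1 (i ∸ 1)) * (k ∸ l i)) [ 2 ⋯ σ ])
    middle-length = trans (length-concatMap middle [ 2 ⋯ σ ])
      (cong sum (map-cong (λ i → length-block (t-maximum 1 (i ∸ 1)) (t i) (k ∸ l i)) [ 2 ⋯ σ ]))

  -- The pair lies in the block of the first level j with i < t j.
  ∈-grid : ∀ {e i p} → 1 ≤ e → e ≤ r → 2 ≤ i → i < t e → 1 ≤ p → p ≤ (k ∸ l e) ⊔ ⌈ k /2⌉ → (i , p) ∈ grid
  ∈-grid {e} {i} {p} 1≤e e≤r 2≤i i<te 1≤p p≤
    with least (λ j → (1 ≤? j) ×-dec (i <? t j)) (e , 1≤e , i<te)
  ... | j , (1≤j , i<tj) , j-min = by-level (m≤n⇒m<n∨m≡n 1≤j) (j ≤? σ)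
    where
    j≤e : j ≤ e
    j≤e = j-min e (1≤e , i<te)
    j≤r : j ≤ r
    j≤r = ≤-trans j≤e e≤r
    earlier : ∀ {m} → m < j → t-maximum 1 m ≤ i
    earlier m<j = t-maximum-≤ λ {j′} 1≤j′ j′≤m → ≮⇒≥ λ i<tj′ →
      <⇒≱ (≤-<-trans j′≤m m<j) (j-min j′ (1≤j′ , i<tj′))
    -- Passing from `e` to the earlier level `j` does not increase `l`, so the bound on positions
    -- can only grow.
    p≤j : p ≤ (k ∸ l j) ⊔ ⌈ k /2⌉
    p≤j = ≤-trans p≤ (⊔-monoˡ-≤ ⌈ k /2⌉ (∸-monoʳ-≤ k (l-mono 1≤j j≤e e≤r)))
    halves : k ∸ ⌊ k /2⌋ ≡ ⌈ k /2⌉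
    halves = trans (cong (_∸ ⌊ k /2⌋) (sym (⌊n/2⌋+⌈n/2⌉≡n k))) (m+n∸m≡n ⌊ k /2⌋ ⌈ k /2⌉)
    by-level : 1 < j ⊎ 1 ≡ j → Dec (j ≤ σ) → (i , p) ∈ grid
    by-level (inj₂ refl) _ = ∈-++⁺ˡ (∈-block 2≤i i<tj 1≤p p≤j)
    -- Up to `σ`, the larger of `k ∸ l j` and `⌈ k /2⌉` is the former; above `σ` it is the latter.
    -- This is the height of the block in either case.
    by-level (inj₁ 1<j) (yes j≤σ) = ∈-++⁺ʳ (block 2 (t 1) _) (∈-++⁺ˡ (∈-concatMap⁺ middle
      (lose (∈-interval⁺ 1<j (s≤s j≤σ))
      (∈-block (earlier (∸-monoʳ-< {j} (s≤s z≤n) 1≤j)) i<tj 1≤p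
        (≤-trans p≤j (⊔-lub ≤-refl (≤-trans (≤-reflexive (sym halves)) (∸-monoʳ-≤ k (low-level 1<j j≤σ)))))))))
    by-level (inj₁ _) (no j≰σ) = ∈-++⁺ʳ (block 2 (t 1) _) (∈-++⁺ʳ (concatMap middle [ 2 ⋯ σ ])
      (∈-block (earlier (≰⇒> j≰σ)) (<-≤-trans i<tj (t-≤-maximum (≰⇒> j≰σ) j≤r)) 1≤p
        (≤-trans p≤j (⊔-lub (≤-trans (∸-monoʳ-≤ k (<⇒≤ (high-level 1≤j j≤r (≰⇒> j≰σ)))) (≤-reflexive halves)) ≤-refl))))

module Levels {n : ℕ} (T : Tree n) where
  open Legs T
  open Lengths T

  sorted-levels : AllPairs _≤_ (levels T)
  sorted-levels = deduplicate-sorted (Linked⇒AllPairs ≤-trans (sort-↗ (map (l-vertex T) (𝓜 T))))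

  module _ (k : ℕ) where
    open LevelGrid k (r T) (l T) (t T) (entry-mono sorted-levels)

    opaque
      -- The value `ℓ w` of a hub occurs as some `l T e`, and then `t T e` is at least the number of
      -- legs at `w`.
      shared-colours : ∃ λ (ips : List (ℕ × ℕ)) → length ips ≡ 𝓘 T k ×
        (∀ {w i p} → Hub w → 2 ≤ i → i < ter T w → 1 ≤ p → p ≤ (k ∸ ℓ w) ⊔ ⌈ k /2⌉ → (i , p) ∈ ips)
      shared-colours = grid , length-grid , λ {w} {i} {p} hub 2≤i i< 1≤p p≤ →
        let e , 1≤e , e≤r , at = entry-∈ (∈-deduplicate⁺ _≟_
              (∈-resp-↭ (↭-sym (sort-↭ (map (l-vertex T) (𝓜 T)))) (∈-map⁺ (l-vertex T) (𝓜⁺ hub))))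
        in ∈-grid 1≤e e≤r 2≤i
          (<-≤-trans i< (maximum-≥ (∈-map⁺ (ter T) (∈-filter⁺ (λ v → l-vertex T v ≟ l T e) (𝓜⁺ hub) (sym at)))))
          1≤p (subst (λ d → p ≤ (k ∸ d) ⊔ ⌈ k /2⌉) (trans (ℓ≡l-vertex w) (sym at)) p≤)

-- The partition into colour classes and the bound

length-concatMap-≤ : ∀ {a b} {A : Set a} {B : Set b} (f : A → List B) {k} → (∀ x → length (f x) ≤ k) →
  ∀ xs → length (concatMap f xs) ≤ length xs * k
length-concatMap-≤ f f≤ []       = z≤n
length-concatMap-≤ f f≤ (x ∷ xs) =
  ≤-trans (≤-reflexive (length-++ (f x))) (+-mono-≤ (f≤ x) (length-concatMap-≤ f f≤ xs))

module _ {a b} {A : Set a} {B : Set b} (f : A → B) where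

  lookup-map-fromList : ∀ xs i → Vec.lookup (Vec.map f (fromList xs)) i ≡ f (lookup xs i)
  lookup-map-fromList (x ∷ xs) zero    = refl
  lookup-map-fromList (x ∷ xs) (suc i) = lookup-map-fromList xs i

  count-map-fromList : ∀ {p} {P : Pred B p} (P? : Decidable P) xs →
    count P? (Vec.map f (fromList xs)) ≡ length (filter (P? ∘ f) xs)
  count-map-fromList P? [] = refl
  count-map-fromList P? (x ∷ xs) with does (P? (f x))
  ... | true  = cong suc (count-map-fromList P? xs)
  ... | false = count-map-fromList P? xs

any-subset-vec? : ∀ {n m} {P : Pred (Vec (Subset n) m) 0ℓ} → Decidable P → Dec (∃ P)
any-subset-vec? {m = zero}  P? = map′ ([] ,_) (λ { ([] , p) → p }) (P? [])
any-subset-vec? {m = suc m} P? = map′ (λ (S , Π , p) → S ∷ Π , p) (λ { (S ∷ Π , p) → S , Π , p })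
  (anySubset? λ S → any-subset-vec? λ Π → P? (S ∷ Π))

∃!? : ∀ {m} {P : Pred (Fin m) 0ℓ} → Decidable P → Dec (∃! _≡_ P)
∃!? P? = map′ (λ (i , p , u) → i , p , λ {j} → u j) (λ (i , p , u) → i , p , λ j → u {j})
  (Fin.any? λ i → P? i ×-dec Fin.all? λ j → P? j →-dec (i Fin.≟ j))

module Partitions {n : ℕ} (T : Tree n) (k : ℕ) where
  open Tree T

  generator? : ∀ {m} → Decidable (IsPartitionGenerator T k {m})
  generator? Π =
    (Fin.all? (λ i → nonempty? (Vec.lookup Π i)) ×-dec Fin.all? (λ x → ∃!? λ i → x ∈? Vec.lookup Π i))
    ×-dec Fin.all? λ x → Fin.all? λ y → ¬? (x Fin.≟ y) →-dec (k ≤? count (distinguishes? T x y) Π)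

  -- Being a generator is decidable and there are finitely many vectors of `m` subsets, so a search
  -- bounded by the given generator finds the minimum.
  dimension-≤ : ∀ {m} → ∃ (IsPartitionGenerator T k {m}) → ∃ λ p → IsPartitionDimension T k p × p ≤ m
  dimension-≤ {m} gen =
    let p , is-least = least (λ m → any-subset-vec? (generator? {m})) (m , gen)
    in p , is-least , proj₂ is-least m gen

  module _ (1≤k : 1 ≤ k) (k≤ς : k ≤ ς T) (¬path : ¬ IsPath graph) where
    open Metric T
    open Legs T
    open Lengths T
    open Colouring T k 1≤k k≤ς
    open Separation T k 1≤k k≤ς
    open Levels T

    -- Only colours that occur are listed, so no class is empty.
    colours : List (Colour n)
    colours = deduplicate _≟ᶜ_ (map colour (allFin n))

    colours-unique : Unique colours
    colours-unique = deduplicate-! _≟ᶜ_ (map colour (allFin n))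

    colour-∈ : ∀ z → colour z ∈ colours
    colour-∈ z = ∈-deduplicate⁺ _≟ᶜ_ (∈-map⁺ colour (∈-allFin z))

    colour-of : ∀ {γ} → γ ∈ colours → ∃ λ z → γ ≡ colour z
    colour-of γ∈ =
      let z , _ , eq = ∈-map⁻ colour (∈-deduplicate⁻ _≟ᶜ_ (map colour (allFin n)) γ∈) in z , eq

    classes : Vec (Subset n) (length colours)
    classes = Vec.map class (fromList colours)

    class⁺ : ∀ {z} i → colour z ≡ lookup colours i → z ∈ₛ Vec.lookup classes i
    class⁺ {z} i eq = subst (z ∈ₛ_) (sym (lookup-map-fromList class colours i))
      (separate⁺ (λ z → colour z ≟ᶜ lookup colours i) eq)

    class⁻ : ∀ {z} i → z ∈ₛ Vec.lookup classes i → colour z ≡ lookup colours i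
    class⁻ {z} i z∈ = separate⁻ (λ z → colour z ≟ᶜ lookup colours i)
      (subst (z ∈ₛ_) (lookup-map-fromList class colours i) z∈)

    classes-partition : IsPartition T classes
    classes-partition =
        (λ i → let z , eq = colour-of (∈-lookup i) in z , class⁺ i (sym eq))
      , (λ x → index (colour-∈ x) , class⁺ (index (colour-∈ x)) (lookup-index (colour-∈ x)) , λ {j} x∈ →
          lookup-injective colours-unique (trans (sym (lookup-index (colour-∈ x))) (class⁻ j x∈)))

    -- The colours of the witnesses are distinct entries of `colours` and so stand for different
    -- members of the partition.
    classes-separate : ∀ x y → x ≢ y → k ≤ count (distinguishes? T x y) classes
    classes-separate x y x≢y = begin
      k                                    ≤⟨ enough ⟩
      length vertices                      ≡⟨ length-map colour vertices ⟨
      length (map colour vertices)         ≤⟨ unique-⊆-length distinct separating-class ⟩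
      length (filter (distinguishes? T x y ∘ class) colours) ≡⟨ count-map-fromList class (distinguishes? T x y) colours ⟨
      count (distinguishes? T x y) classes ∎
      where
      open ≤-Reasoning
      open Witnesses (witnesses ¬path x≢y)
      separating-class : ∀ {γ} → γ ∈ map colour vertices → γ ∈ filter (distinguishes? T x y ∘ class) colours
      separating-class γ∈ = let z , z∈ , eq = ∈-map⁻ colour γ∈ in
        subst (_∈ filter (distinguishes? T x y ∘ class) colours) (sym eq)
          (∈-filter⁺ (distinguishes? T x y ∘ class) (colour-∈ z) (separating z∈))

    -- `singles` takes a proof of `Hub w`, which the decision supplies while running through the
    -- list `𝓜 T`.
    hub-singles : ∀ w → Dec (Hub w) → List (Fin n)
    hub-singles w (yes hub) = singles hub
    hub-singles w (no _)    = []

    hub-singles-length : ∀ w dec → length (hub-singles w dec) ≤ k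
    hub-singles-length w (no _)    = z≤n
    hub-singles-length w (yes hub) = ≤-reflexive (trans (leg-pair-length hub (0F hub) (1F hub))
      (trans (cong₂ (λ i j → size w i + size w j) (0F≡0 hub) (1F≡1 hub)) (m∸n+n≡m (share≤k w))))

    hub-singles⁺ : ∀ {w i z} dec → Hub w → toℕ i < 2 → Spot w i z → z ∈ hub-singles w dec
    hub-singles⁺ (yes hub) _   = singles⁺ hub
    hub-singles⁺ (no ¬hub) hub = contradiction hub ¬hub

    opaque
      all-singles : List (Fin n)
      all-singles = concatMap (λ w → hub-singles w (hub? w)) (𝓜 T)

      all-singles⁺ : ∀ {w i z} → Hub w → toℕ i < 2 → Spot w i z → z ∈ all-singles
      all-singles⁺ {w} hub i<2 spot = ∈-concatMap⁺ (λ w → hub-singles w (hub? w))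
        (lose (𝓜⁺ hub) (hub-singles⁺ (hub? w) hub i<2 spot))

      all-singles-length : length all-singles ≤ κ T * k
      all-singles-length =
        length-concatMap-≤ (λ w → hub-singles w (hub? w)) (λ w → hub-singles-length w (hub? w)) (𝓜 T)

    all-shared : List (ℕ × ℕ)
    all-shared = proj₁ (shared-colours k)

    -- The three parts account for the terms 1, `k * κ T` and `𝓘 T k` of the bound.
    palette : List (Colour n)
    palette = rest ∷ map inj₁ all-singles ++ map inj₂ all-shared

    spot-colour-in-palette : ∀ {w i z} → Hub w → Spot w i z → paint (toℕ i) z (dist w z) ∈ palette
    spot-colour-in-palette {w} {i} {z} hub spot@((z≢w , _) , within) = by-number (toℕ i) refl
      where
      single : toℕ i < 2 → inj₁ z ∈ palette
      single i<2 = there (∈-++⁺ˡ (∈-map⁺ inj₁ (all-singles⁺ hub i<2 spot)))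
      by-number : ∀ m → toℕ i ≡ m → paint m z (dist w z) ∈ palette
      by-number 0 eq = single (≤-trans (≤-reflexive (cong suc eq)) (s≤s z≤n))
      by-number 1 eq = single (≤-reflexive (cong suc eq))
      by-number (suc (suc m)) eq = there (∈-++⁺ʳ (map inj₁ all-singles) (∈-map⁺ inj₂
        (proj₂ (proj₂ (shared-colours k)) hub (s≤s (s≤s z≤n))
          (subst₂ _<_ eq (legs-length w) (Fin.toℕ<n i))
          (n≢0⇒n>0 (z≢w ∘ sym ∘ d≡0⇒≡))
          (subst (λ m → dist w z ≤ size w m) eq within))))

    colour-in-palette : ∀ z → colour z ∈ palette
    colour-in-palette z = [ (λ (w , hub , i , spot , eq) → subst (_∈ palette) (sym eq) (spot-colour-in-palette hub spot))
                          , here ]′ (colour-view z)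

    in-palette : ∀ {γ} → γ ∈ colours → γ ∈ palette
    in-palette γ∈ = let z , eq = colour-of γ∈ in subst (_∈ palette) (sym eq) (colour-in-palette z)

    palette-length : length palette ≤ suc (κ T * k + 𝓘 T k)
    palette-length = s≤s (subst (_≤ κ T * k + 𝓘 T k) (sym split)
      (+-mono-≤ all-singles-length (≤-reflexive (proj₁ (proj₂ (shared-colours k))))))
      where
      split : length (map inj₁ all-singles ++ map inj₂ all-shared) ≡ length all-singles + length all-shared
      split = trans (length-++ (map inj₁ all-singles)) (cong₂ _+_ (length-map inj₁ all-singles) (length-map inj₂ all-shared))

    colours-length : length colours ≤ k * κ T + 𝓘 T k + 1
    colours-length = ≤-trans (unique-⊆-length colours-unique in-palette)
      (≤-trans palette-length (≤-reflexive (rearrange (κ T) k (𝓘 T k))))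
      where
      rearrange : ∀ a b c → suc (a * b + c) ≡ b * a + c + 1
      rearrange a b c = trans (cong (λ i → suc (i + c)) (*-comm a b)) (+-comm 1 (b * a + c))

    dimension-bound : ∃[ p ] (IsPartitionDimension T k p × p ≤ k * κ T + 𝓘 T k + 1)
    dimension-bound =
      let p , dim , p≤ = dimension-≤ (classes , classes-partition , classes-separate)
      in p , dim , ≤-trans p≤ colours-length

theorem26 : ∀ (n : ℕ) (T : Tree n) → ¬ IsPath (Tree.graph T) →
    ∀ (k : ℕ) → 1 ≤ k → k ≤ ς T →
    ∃[ p ] (IsPartitionDimension T k p × p ≤ k * κ T + 𝓘 T k + 1)
theorem26 n T ¬path k 1≤k k≤ς = Partitions.dimension-bound T k 1≤k k≤ς ¬path
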